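{- Let $K$ be a finite $k$-dimensional simplicial complex with $k\ge1$, and let $D$ be the maximum upper degree of a ridge of $K$. Assume that $\Gamma(K)$ is connected and that the signed facet-adjacency graph $\Sigma(K)$ is balanced. Then $$\lambda_1\bigl(L^{\mathrm{up}}_{k-1}(K)\bigr)=D+k$$ if and only if all $k$-faces of $K$ contain one common ridge.
   Context: A simplicial complex $K$ on a finite vertex set is a collection of subsets closed under taking subsets; a face with $m+1$ vertices has dimension $m$, and $K_j$ is the set of $j$-dimensional faces; $K$ is $k$-dimensional if $k$ is the largest dimension of a face. The $k$-faces are called facets and the $(k-1)$-faces ridges. The upper degree of a ridge $\rho$ is $d(\rho)=|\{F\in K_k:\rho\subset F\}|$. Choose an orientation (an ordering of the vertices, up to even permutations) of each face. The boundary matrix $B_k=([\sigma:F])_{\sigma\in K_{k-1},F\in K_k}$ has $[\sigma:F]=0$ if $\sigma\not\subset F$, and if $F=[v_0,\dots,v_k]$ and $\sigma=F\setminus\{v_i\}$ then $[\sigma:F]=(-1)^i\operatorname{sgn}(\pi)$, where $\pi$ is the permutation carrying $(v_0,\dots,\widehat{v_i},\dots,v_k)$ to the chosen ordering of $\sigma$. The up-Laplacian is $L^{\mathrm{up}}_{k-1}(K)=B_kB_k^{\mathsf T}$, and $\lambda_1$ denotes the largest eigenvalue. Two distinct facets $F,G$ are adjacent if they share a ridge $R=F\cap G$; then $\varepsilon(F,G)=[R:F][R:G]\in\{\pm1\}$. The signed facet-adjacency graph $\Sigma(K)$ has vertex set $K_k$, these adjacencies as edges, and $\varepsilon(F,G)$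 as the sign of the edge $FG$; $\Gamma(K)$ is its underlying unsigned graph. A signed graph is balanced if for every cycle the product of the signs of its edges is $+1$. -}

module Defs where

open import Algebra.Bundles using (module CommutativeMonoid)
open import Algebra.Bundles.Raw using (RawMonoid)
open import Algebra.Definitions.RawMonoid using (sum)
import Algebra.Properties.CommutativeSemigroup as CommutativeSemigroup
import Data.Bool.Properties as Bool
open import Data.Fin.Base using (Fin; toℕ)
import Data.Fin.Properties as Fin
open import Data.Fin.Subset using (Subset; inside; outside; _⊆_; _∩_; ∣_∣; _-_)
  renaming (_∈_ to _∈ₛ_)
open import Data.Fin.Subset.Properties using (_⊆?_)
open import Data.Integer.Base as ℤ using (ℤ; 0ℤ; 1ℤ; -1ℤ)
import Data.Integer.Properties as ℤ
open import Data.List.Base as List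
  using (List; []; _∷_; [_]; _++_; length; lookup; map; filter; removeAt)
open import Data.List.Extrema.Nat using (max)
open import Data.List.Membership.Propositional using (_∈_)
open import Data.List.Relation.Unary.Linked using (Linked)
open import Data.List.Relation.Unary.Unique.Propositional using (Unique)
open import Data.Nat.Base as ℕ using (ℕ; zero; suc; _∸_; _⊔_)
import Data.Nat.Properties as ℕ
open import Data.Product.Base using (_×_; _,_; ∃; ∃-syntax; proj₁; proj₂)
open import Data.Rational.Base as ℚ using (ℚ; 0ℚ; 1ℚ; ½)
import Data.Rational.Properties as ℚ
open import Data.Vec.Base using ([]; _∷_)
import Data.Vec.Properties as Vec
open import Function.Bundles using (_⇔_)
open import Level using (0ℓ)
open import Relation.Binary.Construct.Closure.ReflexiveTransitive using (Star)
open import Relation.Binary.Core using (Rel)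
open import Relation.Binary.PropositionalEquality
  using (_≡_; _≢_; sym; trans; cong; subst; module ≡-Reasoning)
open import Relation.Nullary.Decidable using (yes; no; _×-dec_)
open import Relation.Nullary.Negation using (¬_)
open import Relation.Unary using (Decidable)

Cauchy : (ℕ → ℚ) → Set
Cauchy x = ∀ ε → 0ℚ ℚ.< ε →
  ∃[ N ] (∀ m n → N ℕ.≤ m → N ℕ.≤ n → ℚ.∣ x m ℚ.- x n ∣ ℚ.< ε)

record ℝ : Set where
  constructor mkℝ
  field
    seq    : ℕ → ℚ
    cauchy : Cauchy seq

open ℝ public

infix 4 _≈_ _≤ᵣ_

_≈_ : Rel ℝ 0ℓ
x ≈ y = ∀ ε → 0ℚ ℚ.< ε →
  ∃[ N ] (∀ n → N ℕ.≤ n → ℚ.∣ seq x n ℚ.- seq y n ∣ ℚ.< ε)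

_≤ᵣ_ : Rel ℝ 0ℓ
x ≤ᵣ y = ∀ ε → 0ℚ ℚ.< ε →
  ∃[ N ] (∀ n → N ℕ.≤ n → seq x n ℚ.< seq y n ℚ.+ ε)

private
  open CommutativeSemigroup
    (CommutativeMonoid.commutativeSemigroup ℚ.+-0-commutativeMonoid)
    using (interchange)

  half-pos : ∀ {ε} → 0ℚ ℚ.< ε → 0ℚ ℚ.< ε ℚ.* ½
  half-pos {ε} 0<ε =
    subst (ℚ._< ε ℚ.* ½) (ℚ.*-zeroˡ ½) (ℚ.*-monoˡ-<-pos ½ 0<ε)

  halves : ∀ ε → ε ℚ.* ½ ℚ.+ ε ℚ.* ½ ≡ ε
  halves ε = trans (sym (ℚ.*-distribˡ-+ ε ½ ½)) (ℚ.*-identityʳ ε)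

  a-b+b≡a : ∀ a b → (a ℚ.- b) ℚ.+ b ≡ a
  a-b+b≡a a b = trans (ℚ.+-assoc a (ℚ.- b) b)
    (trans (cong (a ℚ.+_) (ℚ.+-inverseˡ b)) (ℚ.+-identityʳ a))

  +-rearrange : ∀ a b c d → (a ℚ.+ b) ℚ.- (c ℚ.+ d) ≡ (a ℚ.- c) ℚ.+ (b ℚ.- d)
  +-rearrange a b c d = trans (cong ((a ℚ.+ b) ℚ.+_) (ℚ.neg-distrib-+ c d))
    (interchange a b (ℚ.- c) (ℚ.- d))

  *-rearrange : ∀ a b c d →
    (a ℚ.* b) ℚ.- (c ℚ.* d) ≡ a ℚ.* (b ℚ.- d) ℚ.+ (a ℚ.- c) ℚ.* d
  *-rearrange a b c d = begin
    a ℚ.* b ℚ.- c ℚ.* d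
      ≡⟨ cong (λ z → a ℚ.* z ℚ.- c ℚ.* d) (sym (a-b+b≡a b d)) ⟩
    a ℚ.* ((b ℚ.- d) ℚ.+ d) ℚ.- c ℚ.* d
      ≡⟨ cong (ℚ._- c ℚ.* d) (ℚ.*-distribˡ-+ a (b ℚ.- d) d) ⟩
    (a ℚ.* (b ℚ.- d) ℚ.+ a ℚ.* d) ℚ.- c ℚ.* d
      ≡⟨ ℚ.+-assoc (a ℚ.* (b ℚ.- d)) (a ℚ.* d) (ℚ.- (c ℚ.* d)) ⟩
    a ℚ.* (b ℚ.- d) ℚ.+ (a ℚ.* d ℚ.- c ℚ.* d)
      ≡⟨ cong (λ z → a ℚ.* (b ℚ.- d) ℚ.+ (a ℚ.* d ℚ.+ z)) (ℚ.neg-distribˡ-* c d) ⟩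
    a ℚ.* (b ℚ.- d) ℚ.+ (a ℚ.* d ℚ.+ (ℚ.- c) ℚ.* d)
      ≡⟨ cong (a ℚ.* (b ℚ.- d) ℚ.+_) (sym (ℚ.*-distribʳ-+ d a (ℚ.- c))) ⟩
    a ℚ.* (b ℚ.- d) ℚ.+ (a ℚ.- c) ℚ.* d ∎
    where open ≡-Reasoning

  ∣+∣-bound : ∀ p q ε →
    ℚ.∣ p ∣ ℚ.< ε ℚ.* ½ → ℚ.∣ q ∣ ℚ.< ε ℚ.* ½ → ℚ.∣ p ℚ.+ q ∣ ℚ.< ε
  ∣+∣-bound p q ε p< q< = ℚ.≤-<-trans (ℚ.∣p+q∣≤∣p∣+∣q∣ p q)
    (subst (ℚ.∣ p ∣ ℚ.+ ℚ.∣ q ∣ ℚ.<_) (halves ε) (ℚ.+-mono-< p< q<))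

  +-cauchy : ∀ x y → Cauchy x → Cauchy y → Cauchy (λ n → x n ℚ.+ y n)
  +-cauchy x y cx cy ε 0<ε = M ⊔ N , λ m n p q →
    subst (λ z → ℚ.∣ z ∣ ℚ.< ε) (sym (+-rearrange (x m) (y m) (x n) (y n)))
      (∣+∣-bound (x m ℚ.- x n) (y m ℚ.- y n) ε
        (proj₂ hx m n (ℕ.m⊔n≤o⇒m≤o M N p) (ℕ.m⊔n≤o⇒m≤o M N q))
        (proj₂ hy m n (ℕ.m⊔n≤o⇒n≤o M N p) (ℕ.m⊔n≤o⇒n≤o M N q)))
    where
    hx = cx (ε ℚ.* ½) (half-pos 0<ε)
    hy = cy (ε ℚ.* ½) (half-pos 0<ε)
    M = proj₁ hx
    N = proj₁ hy

  bounded : ∀ x → Cauchy x →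
    ∃[ b ] ∃[ N ] (ℚ.Positive b × (∀ n → N ℕ.≤ n → ℚ.∣ x n ∣ ℚ.≤ b))
  bounded x cx with cx 1ℚ (ℚ.positive⁻¹ 1ℚ)
  ... | N , h = 1ℚ ℚ.+ ℚ.∣ x N ∣ , N , pos , λ n N≤n → begin
    ℚ.∣ x n ∣
      ≡⟨ cong ℚ.∣_∣ (sym (a-b+b≡a (x n) (x N))) ⟩
    ℚ.∣ (x n ℚ.- x N) ℚ.+ x N ∣
      ≤⟨ ℚ.∣p+q∣≤∣p∣+∣q∣ (x n ℚ.- x N) (x N) ⟩
    ℚ.∣ x n ℚ.- x N ∣ ℚ.+ ℚ.∣ x N ∣
      ≤⟨ ℚ.+-monoˡ-≤ ℚ.∣ x N ∣ (ℚ.<⇒≤ (h n N N≤n ℕ.≤-refl)) ⟩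
    1ℚ ℚ.+ ℚ.∣ x N ∣ ∎
    where
    open ℚ.≤-Reasoning
    pos : ℚ.Positive (1ℚ ℚ.+ ℚ.∣ x N ∣)
    pos = ℚ.positive (ℚ.+-mono-<-≤ {0ℚ} {1ℚ} {0ℚ} (ℚ.positive⁻¹ 1ℚ)
            (ℚ.nonNegative⁻¹ ℚ.∣ x N ∣ {{ℚ.∣-∣-nonNeg (x N)}}))

  scale : ∀ b ε → ℚ.Positive b → 0ℚ ℚ.< ε →
    ∃[ δ ] (0ℚ ℚ.< δ × b ℚ.* δ ≡ ε)
  scale b ε b>0 0<ε = ε ℚ.* b⁻¹ , 0<δ , eq
    where
    instance
      _ = b>0
      _ = ℚ.pos⇒nonZero b
    b⁻¹ = ℚ.1/ b
    instance
      _ = ℚ.1/pos⇒pos b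
    0<δ : 0ℚ ℚ.< ε ℚ.* b⁻¹
    0<δ = subst (ℚ._< ε ℚ.* b⁻¹) (ℚ.*-zeroˡ b⁻¹) (ℚ.*-monoˡ-<-pos b⁻¹ 0<ε)
    eq : b ℚ.* (ε ℚ.* b⁻¹) ≡ ε
    eq = trans (cong (b ℚ.*_) (ℚ.*-comm ε b⁻¹))
        (trans (sym (ℚ.*-assoc b b⁻¹ ε))
        (trans (cong (ℚ._* ε) (ℚ.*-inverseʳ b)) (ℚ.*-identityˡ ε)))

  ∣*∣-bound : ∀ a b c d → ℚ.Positive c →
    ℚ.∣ a ∣ ℚ.≤ c → ℚ.∣ b ∣ ℚ.< d → ℚ.∣ a ℚ.* b ∣ ℚ.< c ℚ.* d
  ∣*∣-bound a b c d c>0 a≤c b<d = begin-strict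
    ℚ.∣ a ℚ.* b ∣       ≡⟨ ℚ.∣p*q∣≡∣p∣*∣q∣ a b ⟩
    ℚ.∣ a ∣ ℚ.* ℚ.∣ b ∣ ≤⟨ ℚ.*-monoʳ-≤-nonNeg ℚ.∣ b ∣ {{ℚ.∣-∣-nonNeg b}} a≤c ⟩
    c ℚ.* ℚ.∣ b ∣       <⟨ ℚ.*-monoʳ-<-pos c {{c>0}} b<d ⟩
    c ℚ.* d             ∎
    where open ℚ.≤-Reasoning

  ∣*∣-cauchy-bound : ∀ x y (cx : Cauchy x) (cy : Cauchy y) ε → 0ℚ ℚ.< ε →
    ∃[ N ] (∀ l m n → N ℕ.≤ l → N ℕ.≤ m → N ℕ.≤ n →
      ℚ.∣ x l ℚ.* (y m ℚ.- y n) ∣ ℚ.< ε)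
  ∣*∣-cauchy-bound x y cx cy ε 0<ε = go (bounded x cx)
    where
    Goal = ∃[ N ] (∀ l m n → N ℕ.≤ l → N ℕ.≤ m → N ℕ.≤ n →
      ℚ.∣ x l ℚ.* (y m ℚ.- y n) ∣ ℚ.< ε)
    go : ∃[ b ] ∃[ N ] (ℚ.Positive b × (∀ n → N ℕ.≤ n → ℚ.∣ x n ∣ ℚ.≤ b)) → Goal
    go (b , M , b>0 , hx) = go′ (scale b ε b>0 0<ε)
      where
      go′ : ∃[ δ ] (0ℚ ℚ.< δ × b ℚ.* δ ≡ ε) → Goal
      go′ (δ , 0<δ , bδ≡ε) = M ⊔ N , λ l m n p q r →
        subst (ℚ.∣ x l ℚ.* (y m ℚ.- y n) ∣ ℚ.<_) bδ≡ε
          (∣*∣-bound (x l) (y m ℚ.- y n) b δ b>0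
            (hx l (ℕ.m⊔n≤o⇒m≤o M N p))
            (proj₂ hy m n (ℕ.m⊔n≤o⇒n≤o M N q) (ℕ.m⊔n≤o⇒n≤o M N r)))
        where
        hy = cy δ 0<δ
        N = proj₁ hy

  *-cauchy : ∀ x y → Cauchy x → Cauchy y → Cauchy (λ n → x n ℚ.* y n)
  *-cauchy x y cx cy ε 0<ε = M ⊔ N , λ m n p q →
    subst (λ z → ℚ.∣ z ∣ ℚ.< ε) (sym (*-rearrange (x m) (y m) (x n) (y n)))
      (∣+∣-bound (x m ℚ.* (y m ℚ.- y n)) ((x m ℚ.- x n) ℚ.* y n) ε
        (proj₂ hxy m m n (ℕ.m⊔n≤o⇒m≤o M N p) (ℕ.m⊔n≤o⇒m≤o M N p)
          (ℕ.m⊔n≤o⇒m≤o M N q))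
        (subst (λ z → ℚ.∣ z ∣ ℚ.< ε ℚ.* ½) (ℚ.*-comm (y n) (x m ℚ.- x n))
          (proj₂ hyx n m n (ℕ.m⊔n≤o⇒n≤o M N q) (ℕ.m⊔n≤o⇒n≤o M N p)
            (ℕ.m⊔n≤o⇒n≤o M N q))))
    where
    hxy = ∣*∣-cauchy-bound x y cx cy (ε ℚ.* ½) (half-pos 0<ε)
    hyx = ∣*∣-cauchy-bound y x cy cx (ε ℚ.* ½) (half-pos 0<ε)
    M = proj₁ hxy
    N = proj₁ hyx

  const-cauchy : ∀ p → Cauchy (λ _ → p)
  const-cauchy p ε 0<ε = 0 , λ _ _ _ _ →
    subst (ℚ._< ε) (sym (cong ℚ.∣_∣ (ℚ.+-inverseʳ p))) 0<ε

infixl 6 _+ᵣ_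
infixl 7 _*ᵣ_

_+ᵣ_ : ℝ → ℝ → ℝ
x +ᵣ y = mkℝ (λ n → seq x n ℚ.+ seq y n) (+-cauchy (seq x) (seq y) (cauchy x) (cauchy y))

_*ᵣ_ : ℝ → ℝ → ℝ
x *ᵣ y = mkℝ (λ n → seq x n ℚ.* seq y n) (*-cauchy (seq x) (seq y) (cauchy x) (cauchy y))

fromℚ : ℚ → ℝ
fromℚ p = mkℝ (λ _ → p) (const-cauchy p)

fromℤ : ℤ → ℝ
fromℤ i = fromℚ (i ℚ./ 1)

0ᵣ : ℝ
0ᵣ = fromℤ 0ℤ

ℝ-+-rawMonoid : RawMonoid 0ℓ 0ℓ
ℝ-+-rawMonoid = record { Carrier = ℝ ; _≈_ = _≈_ ; _∙_ = _+ᵣ_ ; ε = 0ᵣ }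

Matrix : Set → ℕ → ℕ → Set
Matrix A m n = Fin m → Fin n → A

infixl 7 _·_
infix  8 _ᵀ

_ᵀ : ∀ {A m n} → Matrix A m n → Matrix A n m
(M ᵀ) i j = M j i

_·_ : ∀ {l m n} → Matrix ℤ l m → Matrix ℤ m n → Matrix ℤ l n
(M · N) i j = sum ℤ.+-0-rawMonoid (λ h → M i h ℤ.* N h j)

real : ∀ {m n} → Matrix ℤ m n → Matrix ℝ m n
real M i j = fromℤ (M i j)

_·ᵥ_ : ∀ {m n} → Matrix ℝ m n → (Fin n → ℝ) → (Fin m → ℝ)
(M ·ᵥ v) i = sum ℝ-+-rawMonoid (λ j → M i j *ᵣ v j)

IsEigenvalue : ∀ {m} → Matrix ℝ m m → ℝ → Set
IsEigenvalue {m} M μ = ∃ λ (v : Fin m → ℝ) →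
  ¬ (∀ i → v i ≈ 0ᵣ) × (∀ i → (M ·ᵥ v) i ≈ μ *ᵣ v i)

-- Meant for symmetric matrices, all of whose complex eigenvalues are real.
IsLargestEigenvalue : ∀ {m} → Matrix ℝ m m → ℝ → Set
IsLargestEigenvalue M μ = IsEigenvalue M μ × (∀ ν → IsEigenvalue M ν → ν ≤ᵣ μ)

record SimplicialComplex (n : ℕ) : Set₁ where
  field
    Face       : Subset n → Set
    Face?      : Decidable Face
    downClosed : ∀ {σ τ} → σ ⊆ τ → Face τ → Face σ

open SimplicialComplex public

module _ {n : ℕ} (K : SimplicialComplex n) where

  IsFace : ℕ → Subset n → Set
  IsFace j σ = Face K σ × ∣ σ ∣ ≡ suc j

  isFace? : ∀ j → Decidable (IsFace j)
  isFace? j σ = Face? K σ ×-dec (∣ σ ∣ ℕ.≟ suc j)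

  HasDimension : ℕ → Set
  HasDimension k = (∃[ F ] IsFace k F) × (∀ σ → Face K σ → ∣ σ ∣ ℕ.≤ suc k)

  -- For k ≥ 1 only: at k = 0 the truncated k ∸ 1 would make vertices ridges.
  IsRidge : ℕ → Subset n → Set
  IsRidge k = IsFace (k ∸ 1)

allSubsets : ∀ n → List (Subset n)
allSubsets zero    = [ [] ]
allSubsets (suc n) =
  map (outside ∷_) (allSubsets n) ++ map (inside ∷_) (allSubsets n)

module _ {n : ℕ} (K : SimplicialComplex n) where

  faces : ℕ → List (Subset n)
  faces j = filter (isFace? K j) (allSubsets n)

  #faces : ℕ → ℕ
  #faces j = length (faces j)

  upperDegree : ℕ → Subset n → ℕ
  upperDegree k ρ = length (filter (ρ ⊆?_) (faces k))

  maxUpperDegree : ℕ → ℕ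
  maxUpperDegree k = max 0 (map (upperDegree k) (faces (k ∸ 1)))

-- A representative ordering of the vertices is chosen for each face; the value
-- of order on non-faces is unconstrained.
record Orientation {n : ℕ} (K : SimplicialComplex n) : Set where
  field
    order       : Subset n → List (Fin n)
    order-uniq  : ∀ {σ} → Face K σ → Unique (order σ)
    order-verts : ∀ {σ} → Face K σ → ∀ v → v ∈ order σ ⇔ v ∈ₛ σ

open Orientation public

position : ∀ {n} → Fin n → List (Fin n) → ℕ
position v []       = 0
position v (w ∷ ws) with v Fin.≟ w
... | yes _ = 0
... | no  _ = suc (position v ws)

inversions : List ℕ → ℕ
inversions []       = 0
inversions (x ∷ xs) = length (filter (ℕ._<? x) xs) ℕ.+ inversions xs

-- The sign of the permutation carrying vs to ws, for two orderings of the same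
-- set: the list of positions is its one-line notation.
sgn : ∀ {n} → List (Fin n) → List (Fin n) → ℤ
sgn vs ws = -1ℤ ℤ.^ inversions (map (λ v → position v ws) vs)

module _ {n : ℕ} {K : SimplicialComplex n} (o : Orientation K) where

  -- [σ : F] for faces with ∣ F ∣ ≡ suc ∣ σ ∣; then the second case is σ ⊄ F.
  incidence : Subset n → Subset n → ℤ
  incidence σ F with Fin.any? (λ i → Vec.≡-dec Bool._≟_ σ (F - lookup (order o F) i))
  ... | yes (i , _) = -1ℤ ℤ.^ toℕ i ℤ.* sgn (removeAt (order o F) i) (order o σ)
  ... | no _        = 0ℤ

  -- B_{j+1}, with rows K_j and columns K_{j+1}.
  boundary : ∀ j → Matrix ℤ (#faces K j) (#faces K (suc j))
  boundary j σ F = incidence (lookup (faces K j) σ) (lookup (faces K (suc j)) F)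

  upLaplacian : ∀ j → Matrix ℤ (#faces K j) (#faces K j)
  upLaplacian j = boundary j · boundary j ᵀ

module _ {V : Set} (_~_ : Rel V 0ℓ) (ε : V → V → ℤ) where

  walkSign : List V → ℤ
  walkSign (x ∷ y ∷ ws) = ε x y ℤ.* walkSign (y ∷ ws)
  walkSign _            = 1ℤ

  -- A cycle of length at least three is given by its distinct vertices x ∷ xs in
  -- cyclic order, so that x ∷ xs ++ [ x ] is the closed walk around it.
  Balanced : Set
  Balanced = ∀ x xs → 2 ℕ.≤ length xs → Unique (x ∷ xs) →
    Linked _~_ (x ∷ xs ++ [ x ]) → walkSign (x ∷ xs ++ [ x ]) ≡ 1ℤ

module _ {n : ℕ} (K : SimplicialComplex n) (k : ℕ) where

  Adjacent : Rel (Subset n) 0ℓ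
  Adjacent F G = IsFace K k F × IsFace K k G × F ≢ G × IsRidge K k (F ∩ G)

  FacetConnected : Set
  FacetConnected = ∀ F G → IsFace K k F → IsFace K k G → Star Adjacent F G

  adjacencySign : Orientation K → Subset n → Subset n → ℤ
  adjacencySign o F G = incidence o (F ∩ G) F ℤ.* incidence o (F ∩ G) G

  FacetBalanced : Orientation K → Set
  FacetBalanced o = Balanced Adjacent (adjacencySign o)

  HaveCommonRidge : Set
  HaveCommonRidge = ∃[ ρ ] (IsRidge K k ρ × (∀ F → IsFace K k F → ρ ⊆ F))

{-# OPTIONS --safe #-}

-- Let B be the boundary matrix. Balance gives a sign s on facets such that C = B diag(s) satisfies
-- L = C Cᵀ and A = Cᵀ C ≥ 0; the diagonal entries of A are k + 1, the other entries are 1 for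
-- adjacent facets and 0 otherwise.
--
-- If all facets contain one ridge, then A = k I + J for the all-ones matrix J of size D, so that the
-- nonzero spectrum of L lies in {k, D + k} and D + k occurs.
--
-- If not, let χ be the indicator of the star of a ridge of degree D. By connectedness some facet f
-- outside the star is adjacent to a member of it, whence A χ ≥ (D + k) χ + e_f. As A is nonnegative and
-- irreducible, its Perron root exceeds D + k. Eigenpairs have to be exhibited as Cauchy sequences:
-- the Perron vector is the limit of a power iteration, whose convergence rate comes from Doeblin's
-- contraction argument.

module Submission where

open import Defs

-- `IsLargestEigenvalue` compares `μ` only with eigenpairs that are exhibited, so a Rayleigh
-- quotient above `D + k` refutes nothing by itself: an actual real eigenvector is needed, and
-- Cauchy reals give neither a maximiser nor a test for zero. It is found on the dual side. For
-- positive `w₀`, the ratio of `(Q ^ t) u` to `(Q ^ t) w₀`, with both numbers read off at one fixed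
-- facet or normalised there, is for every `t` an exactly linear and monotone functional of `u`. Its
-- limit is the left Perron vector, and evaluating it on the rows of `C` carries that vector from
-- facets to ridges. Exactness at each `t` leaves the convergence of the ratios as the main
-- estimate. `Q` is a power of `A` whose entries in the row and the column of the fixed facet are at
-- least 1.
--
-- For a common ridge, an eigenvalue above `D + k` by a fixed margin would allow division by the
-- relevant differences, and its eigenvector would vanish. This negative conclusion suffices because
-- the comparison of reals is stable under double negation.

-- Rational arithmetic and finite sums.

module RationalSums where

  open import Algebra.Bundles using (CommutativeRing)
  open import Data.Fin.Base using (Fin; zero; suc)
  open import Data.Integer.Base as ℤ using (ℤ; +_; -[1+_])
  import Data.Integer.Properties as ℤ
  open import Data.Nat.Base as ℕ using (ℕ; zero; suc)
  import Data.Nat.Coprimality as Coprime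
  import Data.Nat.Properties as ℕ
  open import Data.Product.Base using (∃-syntax; _×_; _,_)
  open import Data.Rational.Base
  open import Data.Rational.Properties
  open import Data.Rational.Solver using (module +-*-Solver)
  open import Relation.Binary.PropositionalEquality

  open +-*-Solver using (solve; _:=_; _:+_; _:-_)

  open import Algebra.Properties.Semiring.Sum
    (CommutativeRing.semiring +-*-commutativeRing) public
    using (sum; *-distribˡ-sum; *-distribʳ-sum; ∑-distrib-+; ∑-comm; sum-cong-≗)

  ι : ℤ → ℚ
  ι i = i / 1

  fromℕ : ℕ → ℚ
  fromℕ n = ι (+ n)

  -- `i / 1` is normalised through a gcd that is stuck for variable `i`; rewriting it to an explicit
  -- reduced fraction lets rational arithmetic compute.
  ι-mkℚ : ∀ i → ι i ≡ mkℚ i 0 (Coprime.sym (Coprime.1-coprimeTo _))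
  ι-mkℚ i = ↥p/↧p≡p (mkℚ i 0 (Coprime.sym (Coprime.1-coprimeTo _)))

  ι-+ : ∀ i j → ι (i ℤ.+ j) ≡ ι i + ι j
  ι-+ i j rewrite ι-mkℚ i | ι-mkℚ j | ℤ.*-identityʳ i | ℤ.*-identityʳ j = refl

  ι-* : ∀ i j → ι (i ℤ.* j) ≡ ι i * ι j
  ι-* i j rewrite ι-mkℚ i | ι-mkℚ j = refl

  ι-mono-≤ : ∀ {i j} → i ℤ.≤ j → ι i ≤ ι j
  ι-mono-≤ {i} {j} i≤j rewrite ι-mkℚ i | ι-mkℚ j =
    *≤* (subst₂ ℤ._≤_ (sym (ℤ.*-identityʳ i)) (sym (ℤ.*-identityʳ j)) i≤j)

  fromℕ-suc : ∀ n → fromℕ (suc n) ≡ 1ℚ + fromℕ n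
  fromℕ-suc n = ι-+ (+ 1) (+ n)

  0≤fromℕ : ∀ n → 0ℚ ≤ fromℕ n
  0≤fromℕ n = ι-mono-≤ {+ 0} {+ n} (ℤ.+≤+ ℕ.z≤n)

  -- The denominator is at least 1, so the size of the numerator already bounds `p`.
  p<fromℕ : ∀ p → p < fromℕ (suc ℤ.∣ ↥ p ∣)
  p<fromℕ p@(mkℚ a d-1 _) rewrite ι-mkℚ (+ suc ℤ.∣ a ∣) = *<* (subst (ℤ._< + suc ℤ.∣ a ∣ ℤ.* + suc d-1) (sym (ℤ.*-identityʳ a)) (go a))
    where
    go : ∀ a → a ℤ.< + suc ℤ.∣ a ∣ ℤ.* + suc d-1
    go (+ n)    = ℤ.+<+ (ℕ.m≤m*n (suc n) (suc d-1))
    go -[1+ n ] = ℤ.-<+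

  *-monoˡ-≤ : ∀ {c a b} → 0ℚ ≤ c → a ≤ b → c * a ≤ c * b
  *-monoˡ-≤ {c} 0≤c = *-monoˡ-≤-nonNeg c {{nonNegative 0≤c}}

  *-monoʳ-≤ : ∀ {c a b} → 0ℚ ≤ c → a ≤ b → a * c ≤ b * c
  *-monoʳ-≤ {c} 0≤c = *-monoʳ-≤-nonNeg c {{nonNegative 0≤c}}

  0≤* : ∀ {a b} → 0ℚ ≤ a → 0ℚ ≤ b → 0ℚ ≤ a * b
  0≤* {a} {b} 0≤a 0≤b = subst (_≤ a * b) (*-zeroʳ a) (*-monoˡ-≤ 0≤a 0≤b)

  0<* : ∀ {a b} → 0ℚ < a → 0ℚ < b → 0ℚ < a * b
  0<* {a} {b} 0<a 0<b = subst (_< a * b) (*-zeroʳ a) (*-monoʳ-<-pos a {{positive 0<a}} 0<b)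

  0<1 : 0ℚ < 1ℚ
  0<1 = positive⁻¹ 1ℚ

  1/-pos : ∀ c → 0ℚ < c → ∃[ d ] (0ℚ < d × c * d ≡ 1ℚ)
  1/-pos c 0<c = 1/ c , positive⁻¹ (1/ c) {{1/pos⇒pos c}} , *-inverseʳ c
    where
    instance
      _ = positive 0<c
      _ = pos⇒nonZero c

  p≤q⇒0≤q-p : ∀ {p q} → p ≤ q → 0ℚ ≤ q - p
  p≤q⇒0≤q-p {p} {q} p≤q = subst (_≤ q - p) (+-inverseʳ p) (+-monoˡ-≤ (- p) p≤q)

  0≤q-p⇒p≤q : ∀ {p q} → 0ℚ ≤ q - p → p ≤ q
  0≤q-p⇒p≤q {p} {q} h = subst₂ _≤_ (+-identityˡ p)
    (solve 2 (λ p q → (q :- p) :+ p := q) refl p q) (+-monoˡ-≤ p h)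

  sum-mono : ∀ {n} {f g : Fin n → ℚ} → (∀ i → f i ≤ g i) → sum f ≤ sum g
  sum-mono {zero}  h = ≤-refl
  sum-mono {suc n} h = +-mono-≤ (h zero) (sum-mono (λ i → h (suc i)))

  sum-0 : ∀ {n} {f : Fin n → ℚ} → (∀ i → f i ≡ 0ℚ) → sum f ≡ 0ℚ
  sum-0 {zero}  h = refl
  sum-0 {suc n} h = cong₂ _+_ (h zero) (sum-0 (λ i → h (suc i)))

  0≤sum : ∀ {n} {f : Fin n → ℚ} → (∀ i → 0ℚ ≤ f i) → 0ℚ ≤ sum f
  0≤sum {zero}  h = ≤-refl
  0≤sum {suc n} h = +-mono-≤ (h zero) (0≤sum (λ i → h (suc i)))

  term≤sum : ∀ {n} {f : Fin n → ℚ} → (∀ i → 0ℚ ≤ f i) → ∀ i → f i ≤ sum f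
  term≤sum {suc n} {f} h zero    = subst (_≤ sum f) (+-identityʳ (f zero))
    (+-monoʳ-≤ (f zero) (0≤sum (λ i → h (suc i))))
  term≤sum {suc n} {f} h (suc i) = ≤-trans (term≤sum (λ i → h (suc i)) i)
    (subst (_≤ sum f) (+-identityˡ _) (+-monoˡ-≤ _ (h zero)))

  upperBound : ∀ {n} (f : Fin n → ℚ) → ∃[ b ] (0ℚ < b × (∀ i → f i ≤ b))
  upperBound {zero}  f = 1ℚ , 0<1 , λ ()
  upperBound {suc n} f with upperBound (λ i → f (suc i))
  ... | b , 0<b , h = b ⊔ f zero , <-≤-trans 0<b (p≤p⊔q b (f zero)) , λ
    { zero → p≤q⊔p b (f zero) ; (suc i) → ≤-trans (h i) (p≤p⊔q b (f zero)) }

  archimedean : ∀ ε K → 0ℚ < ε → ∃[ n ] (K < ε * fromℕ n)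
  archimedean ε K 0<ε with 1/-pos ε 0<ε
  ... | δ , 0<δ , εδ≡1 = n , subst (_< ε * fromℕ n) eq
      (*-monoʳ-<-pos ε {{positive 0<ε}} (p<fromℕ (δ * K)))
    where
    n = suc ℤ.∣ ↥ (δ * K) ∣
    eq : ε * (δ * K) ≡ K
    eq = trans (sym (*-assoc ε δ K)) (trans (cong (_* K) εδ≡1) (*-identityˡ K))

  -- Widths O(1/t) are all that the convergence proofs below need, although they decay geometrically.
  decay : ∀ m K ε → 0ℚ ≤ m → 0ℚ < ε →
    ∃[ N ] (∀ t → N ℕ.≤ t → ∀ x → x * (m + fromℕ t) ≤ K → x < ε)
  decay m K ε 0≤m 0<ε with archimedean ε K 0<ε
  ... | N , K<εN = N , λ t N≤t x hx → ≰⇒> λ ε≤x → <-irrefl refl (begin-strict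
    K                  <⟨ K<εN ⟩
    ε * fromℕ N        ≤⟨ *-monoˡ-≤ (<⇒≤ 0<ε) (ι-mono-≤ {+ N} {+ t} (ℤ.+≤+ N≤t)) ⟩
    ε * fromℕ t        ≡⟨ cong (ε *_) (sym (+-identityˡ _)) ⟩
    ε * (0ℚ + fromℕ t) ≤⟨ *-monoˡ-≤ (<⇒≤ 0<ε) (+-monoˡ-≤ (fromℕ t) 0≤m) ⟩
    ε * (m + fromℕ t)  ≤⟨ *-monoʳ-≤ (+-mono-≤ 0≤m (0≤fromℕ t)) ε≤x ⟩
    x * (m + fromℕ t)  ≤⟨ hx ⟩
    K                  ∎)
    where open ≤-Reasoning

-- Rational sequences that tend to zero.

module NullSequences where

  open RationalSums
  open import Data.Fin.Base using (Fin; zero; suc)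
  open import Data.Nat.Base as ℕ using (ℕ; zero; suc)
  import Data.Nat.Properties as ℕ
  open import Data.Product.Base using (∃-syntax; _,_)
  open import Data.Rational.Base
  open import Data.Rational.Properties
  open import Data.Rational.Solver using (module +-*-Solver)
  open import Data.Sum.Base using (inj₁; inj₂)
  open import Relation.Binary.PropositionalEquality
  open +-*-Solver using (solve; _:=_; _:+_; _:*_; _:-_; :-_; con)

  Null : (ℕ → ℚ) → Set
  Null x = ∀ ε → 0ℚ < ε → ∃[ N ] (∀ n → N ℕ.≤ n → ∣ x n ∣ < ε)

  ∣p∣≤ : ∀ {p q} → p ≤ q → - p ≤ q → ∣ p ∣ ≤ q
  ∣p∣≤ {p} {q} p≤q -p≤q with ∣p∣≡p∨∣p∣≡-p p
  ... | inj₁ eq = subst (_≤ q) (sym eq) p≤q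
  ... | inj₂ eq = subst (_≤ q) (sym eq) -p≤q

  p≤∣p∣ : ∀ p → p ≤ ∣ p ∣
  p≤∣p∣ p with ≤-total 0ℚ p
  ... | inj₁ 0≤p = ≤-reflexive (sym (0≤p⇒∣p∣≡p 0≤p))
  ... | inj₂ p≤0 = ≤-trans p≤0 (0≤∣p∣ p)

  ∣p-q∣≤width : ∀ {l h p q} → l ≤ p → p ≤ h → l ≤ q → q ≤ h → ∣ p - q ∣ ≤ h - l
  ∣p-q∣≤width {l} {h} {p} {q} l≤p p≤h l≤q q≤h = ∣p∣≤
    (+-mono-≤ p≤h (neg-antimono-≤ l≤q))
    (subst (_≤ h - l) (solve 2 (λ p q → q :- p := :- (p :- q)) refl p q)
      (+-mono-≤ q≤h (neg-antimono-≤ l≤p)))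

  null-cong : ∀ {x y} → (∀ n → x n ≡ y n) → Null x → Null y
  null-cong x≡y hx ε 0<ε with hx ε 0<ε
  ... | N , h = N , λ n N≤n → subst (λ z → ∣ z ∣ < ε) (x≡y n) (h n N≤n)

  half : ∀ {ε} → 0ℚ < ε → 0ℚ < ε * ½
  half 0<ε = 0<* 0<ε (positive⁻¹ ½)

  null-+ : ∀ {x y} → Null x → Null y → Null (λ n → x n + y n)
  null-+ {x} {y} hx hy ε 0<ε with hx (ε * ½) (half 0<ε) | hy (ε * ½) (half 0<ε)
  ... | M , p | N , q = M ℕ.⊔ N , λ n h → begin-strict
    ∣ x n + y n ∣     ≤⟨ ∣p+q∣≤∣p∣+∣q∣ (x n) (y n) ⟩
    ∣ x n ∣ + ∣ y n ∣ <⟨ +-mono-< (p n (ℕ.m⊔n≤o⇒m≤o M N h)) (q n (ℕ.m⊔n≤o⇒n≤o M N h)) ⟩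
    ε * ½ + ε * ½     ≡⟨ solve 1 (λ e → e :* con ½ :+ e :* con ½ := e) refl ε ⟩
    ε                 ∎
    where open ≤-Reasoning

  null-0 : Null (λ _ → 0ℚ)
  null-0 ε 0<ε = 0 , λ _ _ → 0<ε

  null-sum : ∀ {k} {x : Fin k → ℕ → ℚ} → (∀ i → Null (x i)) → Null (λ n → sum (λ i → x i n))
  null-sum {zero}  h = null-0
  null-sum {suc k} h = null-+ (h zero) (null-sum (λ i → h (suc i)))

  -- Stands in for division by `x`: its terms stay away from 0 from `M` on, so no reciprocals have
  -- to be formed.
  null-cancel : ∀ {δ} (x y : ℕ → ℚ) → 0ℚ < δ → ∃[ M ] (∀ n → M ℕ.≤ n → δ ≤ ∣ x n ∣) →
    Null (λ n → x n * y n) → Null y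
  null-cancel {δ} x y 0<δ (M , hx) hxy ε 0<ε with hxy (δ * ε) (0<* 0<δ 0<ε)
  ... | N , h = M ℕ.⊔ N , λ n M⊔N≤n → ≰⇒> λ ε≤y → <-irrefl refl (begin-strict
    δ * ε              ≤⟨ *-monoˡ-≤ (<⇒≤ 0<δ) ε≤y ⟩
    δ * ∣ y n ∣        ≤⟨ *-monoʳ-≤ (0≤∣p∣ (y n)) (hx n (ℕ.m⊔n≤o⇒m≤o M N M⊔N≤n)) ⟩
    ∣ x n ∣ * ∣ y n ∣  ≡⟨ sym (∣p*q∣≡∣p∣*∣q∣ (x n) (y n)) ⟩
    ∣ x n * y n ∣      <⟨ h n (ℕ.m⊔n≤o⇒n≤o M N M⊔N≤n) ⟩
    δ * ε              ∎)
    where open ≤-Reasoning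

  null-scale : ∀ c {x} → Null x → Null (λ n → c * x n)
  -- `1 + ∣ c ∣` is invertible even when `c` is zero.
  null-scale c {x} hx ε 0<ε with 1/-pos (1ℚ + ∣ c ∣) (+-mono-<-≤ 0<1 (0≤∣p∣ c))
  ... | d , 0<d , eq with hx (d * ε) (0<* 0<d 0<ε)
  ...   | N , h = N , λ n N≤n → begin-strict
    ∣ c * x n ∣                 ≡⟨ ∣p*q∣≡∣p∣*∣q∣ c (x n) ⟩
    ∣ c ∣ * ∣ x n ∣             ≤⟨ *-monoˡ-≤ (0≤∣p∣ c) (<⇒≤ (h n N≤n)) ⟩
    ∣ c ∣ * (d * ε)             ≡⟨ sym (+-identityˡ _) ⟩
    0ℚ + ∣ c ∣ * (d * ε)        <⟨ +-monoˡ-< (∣ c ∣ * (d * ε)) (0<* 0<d 0<ε) ⟩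
    d * ε + ∣ c ∣ * (d * ε)     ≡⟨ solve 3 (λ c d e → d :* e :+ c :* (d :* e) := (con 1ℚ :+ c) :* d :* e) refl ∣ c ∣ d ε ⟩
    (1ℚ + ∣ c ∣) * d * ε        ≡⟨ cong (_* ε) eq ⟩
    1ℚ * ε                      ≡⟨ *-identityˡ ε ⟩
    ε                           ∎
    where open ≤-Reasoning

-- Positive linear operators and the contraction of ratios.

module PositiveOperators where

  open RationalSums
  open NullSequences
  open import Data.Fin.Base using (Fin; zero; suc)
  open import Data.Nat.Base as ℕ using (ℕ; zero; suc)
  import Data.Nat.Properties as ℕ
  open import Data.Product.Base using (∃-syntax; _,_; proj₁; proj₂)
  open import Data.Rational.Base hiding (Positive; NonNegative)
  open import Data.Rational.Properties
  open import Data.Rational.Solver using (module +-*-Solver)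
  open import Relation.Binary.PropositionalEquality
  open import Relation.Nullary.Decidable using (yes; no)
  open +-*-Solver using (solve; _:=_; _:+_; _:*_; _:-_; :-_; con)

  Vector : ℕ → Set
  Vector n = Fin n → ℚ

  Operator : ℕ → Set
  Operator n = Vector n → Vector n

  NonNegative : ∀ {n} → Vector n → Set
  NonNegative z = ∀ i → 0ℚ ≤ z i

  record Positive {n} (T : Operator n) : Set where
    field
      monotone    : ∀ {a b} → (∀ i → a i ≤ b i) → ∀ i → T a i ≤ T b i
      additive    : ∀ a b i → T (λ j → a j + b j) i ≡ T a i + T b i
      homogeneous : ∀ c a i → T (λ j → c * a j) i ≡ c * T a i

    -- Vectors are functions and are compared pointwise, without extensionality; monotonicity in
    -- both directions makes `T` respect that comparison.
    congruent : ∀ {a b} → (∀ i → a i ≡ b i) → ∀ i → T a i ≡ T b i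
    congruent a≡b i = ≤-antisym (monotone (λ j → ≤-reflexive (a≡b j)) i)
      (monotone (λ j → ≤-reflexive (sym (a≡b j))) i)

    zero-preserving : ∀ i → T (λ _ → 0ℚ) i ≡ 0ℚ
    zero-preserving i = trans (congruent (λ j → sym (*-zeroˡ 0ℚ)) i)
      (trans (homogeneous 0ℚ (λ _ → 0ℚ) i) (*-zeroˡ (T (λ _ → 0ℚ) i)))

    nonNegative-preserving : ∀ {a} → NonNegative a → NonNegative (T a)
    nonNegative-preserving {a} 0≤a i = subst (_≤ T a i) (zero-preserving i) (monotone 0≤a i)

    combination : ∀ a c b i → T (λ j → a j - c * b j) i ≡ T a i - c * T b i
    combination a c b i = begin
      T (λ j → a j - c * b j) i
        ≡⟨ congruent (λ j → cong (a j +_) (neg-distribˡ-* c (b j))) i ⟩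
      T (λ j → a j + (- c) * b j) i
        ≡⟨ additive a (λ j → (- c) * b j) i ⟩
      T a i + T (λ j → (- c) * b j) i
        ≡⟨ cong (T a i +_) (trans (homogeneous (- c) b i) (sym (neg-distribˡ-* c (T b i)))) ⟩
      T a i - c * T b i ∎
      where open ≡-Reasoning

    sum-preserving : ∀ {k} (c : Fin k → ℚ) (u : Fin k → Vector n) j →
      T (λ j → sum (λ i → c i * u i j)) j ≡ sum (λ i → c i * T (u i) j)
    sum-preserving {zero}  c u j = zero-preserving j
    sum-preserving {suc k} c u j = trans
      (additive (λ j → c zero * u zero j) (λ j → sum (λ i → c (suc i) * u (suc i) j)) j)
      (cong₂ _+_ (homogeneous (c zero) (u zero) j)
        (sum-preserving (λ i → c (suc i)) (λ i → u (suc i)) j))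

  open Positive public

  infixl 8 _^_

  _^_ : ∀ {n} → Operator n → ℕ → Operator n
  (T ^ zero)  z = z
  (T ^ suc t) z = T ((T ^ t) z)

  positive-^ : ∀ {n} {T : Operator n} → Positive T → ∀ t → Positive (T ^ t)
  positive-^ T⁺ zero    = record
    { monotone = λ a≤b → a≤b ; additive = λ _ _ _ → refl ; homogeneous = λ _ _ _ → refl }
  positive-^ {T = T} T⁺ (suc t) = record
    { monotone    = λ a≤b → monotone T⁺ (monotone T^t⁺ a≤b)
    ; additive    = λ a b i → trans (congruent T⁺ (additive T^t⁺ a b) i)
        (additive T⁺ ((T ^ t) a) ((T ^ t) b) i)
    ; homogeneous = λ c a i → trans (congruent T⁺ (homogeneous T^t⁺ c a) i)
        (homogeneous T⁺ c ((T ^ t) a) i)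
    }
    where T^t⁺ = positive-^ T⁺ t

  ^-commute : ∀ {n} {S T : Operator n} → (∀ z → S (T z) ≡ T (S z)) →
    ∀ t z → (S ^ t) (T z) ≡ T ((S ^ t) z)
  ^-commute         ST≡TS zero    z = refl
  ^-commute {S = S} ST≡TS (suc t) z = trans (cong S (^-commute ST≡TS t z)) (ST≡TS ((S ^ t) z))

  -- Doeblin's argument: the ratios of (Q ^ t) u to (Q ^ t) w₀ are confined to intervals that
  -- shrink, because every application of Q mixes the ratio at o into all the others.
  module Contraction {n} {Q : Operator n} (Q⁺ : Positive Q) (o : Fin n)
    (spread : ∀ {z} → NonNegative z → ∀ i → z o ≤ Q z i)
    (gather : ∀ {z} → NonNegative z → ∀ i → z i ≤ Q z o)
    {w₀ : Vector n} (1≤w₀ : ∀ i → 1ℚ ≤ w₀ i) where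

    w : ℕ → Vector n
    w t = (Q ^ t) w₀

    0≤w₀ : NonNegative w₀
    0≤w₀ i = ≤-trans (<⇒≤ 0<1) (1≤w₀ i)

    0≤w : ∀ t → NonNegative (w t)
    0≤w t = nonNegative-preserving (positive-^ Q⁺ t) 0≤w₀

    0<w : ∀ t i → 0ℚ < w t i
    0<w zero    i = <-≤-trans 0<1 (1≤w₀ i)
    0<w (suc t) i = <-≤-trans (0<w t o) (spread (0≤w t) i)

    private
      bound = upperBound (Q w₀)
      R = proj₁ bound
      0<R = proj₁ (proj₂ bound)
      -- The Harnack constant: one factor `R` is paid at `i`, the other at `o`. Below, `m` is `2S`
      -- because each step removes the fraction `1/(2S)` of the gap.
      S = R * R
      0<S = 0<* 0<R 0<R
      inverse-S = 1/-pos S 0<S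
      S⁻¹ = proj₁ inverse-S
      m = S + S

      Qw₀≤Rw₀ : ∀ i → Q w₀ i ≤ R * w₀ i
      Qw₀≤Rw₀ i = ≤-trans (proj₂ (proj₂ bound) i)
        (subst (_≤ R * w₀ i) (*-identityʳ R) (*-monoˡ-≤ (<⇒≤ 0<R) (1≤w₀ i)))

      -- The bound holds at `t = 0` since `w₀` is at least 1, and `Q ^ t` carries it along because
      -- it is positive and commutes with `Q`.
      growth : ∀ t i → Q (w t) i ≤ R * w t i
      growth t i = begin
        Q (w t) i                     ≡⟨ cong (λ z → z i) (sym (^-commute {T = Q} (λ _ → refl) t w₀)) ⟩
        (Q ^ t) (Q w₀) i              ≤⟨ monotone (positive-^ Q⁺ t) Qw₀≤Rw₀ i ⟩
        (Q ^ t) (λ j → R * w₀ j) i    ≡⟨ homogeneous (positive-^ Q⁺ t) R w₀ i ⟩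
        R * w t i                     ∎
        where open ≤-Reasoning

      -- A Harnack inequality: every entry of the next iterate is controlled by the present entry at
      -- `o`, with a constant independent of `t`.
      harnack : ∀ t i → Q (w t) i ≤ S * w t o
      harnack t i = begin
        Q (w t) i         ≤⟨ growth t i ⟩
        R * w t i         ≤⟨ *-monoˡ-≤ (<⇒≤ 0<R) (gather (0≤w t) i) ⟩
        R * Q (w t) o     ≤⟨ *-monoˡ-≤ (<⇒≤ 0<R) (growth t o) ⟩
        R * (R * w t o)   ≡⟨ sym (*-assoc R R (w t o)) ⟩
        S * w t o         ∎
        where open ≤-Reasoning

      -- The vector `z - l w` is nonnegative and has the surplus `S d w` at `o`. One application of
      -- `Q` spreads this surplus to every coordinate, where `harnack` makes it worth at least `d`
      -- times the new `w`.
      raise : ∀ t z l d → 0ℚ ≤ d → (∀ i → l * w t i ≤ z i) → (l + S * d) * w t o ≤ z o →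
        ∀ i → (l + d) * w (suc t) i ≤ Q z i
      raise t z l d 0≤d l≤ mid≤ i = 0≤q-p⇒p≤q (subst (0ℚ ≤_) eq
        (+-mono-≤ (p≤q⇒0≤q-p above) (p≤q⇒0≤q-p (*-monoˡ-≤ 0≤d (harnack t i)))))
        where
        above : S * d * w t o ≤ Q z i - l * Q (w t) i
        above = begin
          S * d * w t o
            ≡⟨ solve 4 (λ S d w l → S :* d :* w := (l :+ S :* d) :* w :- l :* w) refl S d (w t o) l ⟩
          (l + S * d) * w t o - l * w t o
            ≤⟨ +-monoˡ-≤ (- (l * w t o)) mid≤ ⟩
          z o - l * w t o
            ≤⟨ spread (λ j → p≤q⇒0≤q-p (l≤ j)) i ⟩
          Q (λ j → z j - l * w t j) i
            ≡⟨ combination Q⁺ z l (w t) i ⟩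
          Q z i - l * Q (w t) i ∎
          where open ≤-Reasoning
        eq : ((Q z i - l * Q (w t) i) - S * d * w t o) + (d * (S * w t o) - d * Q (w t) i)
           ≡ Q z i - (l + d) * Q (w t) i
        eq = solve 6 (λ z l W S d w →
               ((z :- l :* W) :- S :* d :* w) :+ (d :* (S :* w) :- d :* W)
               := z :- (l :+ d) :* W) refl (Q z i) l (Q (w t) i) S d (w t o)

    -- The interval holds all ratios of `(Q ^ t) u` to `w t`. Its length is weighted by `m + t`, so
    -- that one constant `K` serves for every `t`.
    record Bracket (u : Vector n) (K : ℚ) (t : ℕ) : Set where
      field
        lo hi : ℚ
        lo≤   : ∀ i → lo * w t i ≤ (Q ^ t) u i
        ≤hi   : ∀ i → (Q ^ t) u i ≤ hi * w t i
        width : (hi - lo) * (m + fromℕ t) ≤ K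

    open Bracket

    lo≤hi : ∀ {u K t} (b : Bracket u K t) → lo b ≤ hi b
    lo≤hi {t = t} b = *-cancelʳ-≤-pos (w t o) {{positive (0<w t o)}} (≤-trans (lo≤ b o) (≤hi b o))

    private
      -- Chosen so that `l + S * step l h` is the midpoint of the interval, the threshold at which
      -- `raise` is applied.
      step : ℚ → ℚ → ℚ
      step l h = (h - l) * ½ * S⁻¹

      0≤step : ∀ {l h} → l ≤ h → 0ℚ ≤ step l h
      0≤step l≤h = 0≤* (0≤* (p≤q⇒0≤q-p l≤h) (<⇒≤ (positive⁻¹ ½))) (<⇒≤ (proj₁ (proj₂ inverse-S)))

      S*step : ∀ l h → S * step l h ≡ (h - l) * ½
      S*step l h = trans
        (solve 3 (λ S g T → S :* (g :* con ½ :* T) := g :* con ½ :* (S :* T)) refl S (h - l) S⁻¹)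
        (trans (cong ((h - l) * ½ *_) (proj₂ (proj₂ inverse-S))) (*-identityʳ ((h - l) * ½)))

      -- With gap `g` and `2 S d = g`, adding 1 to the weight costs exactly what the part `2 S d` of
      -- the cut returns: the product changes by `- d (1 + t)`, which is not positive.
      narrow : ∀ {K l h} t → l ≤ h → (h - l) * (m + fromℕ t) ≤ K →
        ((h - l) - step l h) * (m + fromℕ (suc t)) ≤ K
      narrow {K} {l} {h} t l≤h width = ≤-trans (begin
        (g - d) * (m + fromℕ (suc t))
          ≡⟨ cong (λ f → (g - d) * (m + f)) (fromℕ-suc t) ⟩
        (g - d) * (m + (1ℚ + fromℕ t))
          ≡⟨ solve 4 (λ g d S f → (g :- d) :* (S :+ S :+ (con 1ℚ :+ f))
               := g :* (S :+ S :+ f) :+ (g :- (S :* d :+ S :* d)) :- d :* (con 1ℚ :+ f))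
               refl g d S (fromℕ t) ⟩
        g * (m + fromℕ t) + (g - (S * d + S * d)) - d * (1ℚ + fromℕ t)
          ≡⟨ cong (λ e → g * (m + fromℕ t) + (g - (e + e)) - d * (1ℚ + fromℕ t)) (S*step l h) ⟩
        g * (m + fromℕ t) + (g - (g * ½ + g * ½)) - d * (1ℚ + fromℕ t)
          ≡⟨ solve 3 (λ a g b → a :+ (g :- (g :* con ½ :+ g :* con ½)) :- b := a :- b)
               refl (g * (m + fromℕ t)) g (d * (1ℚ + fromℕ t)) ⟩
        g * (m + fromℕ t) - d * (1ℚ + fromℕ t)
          ≤⟨ +-monoʳ-≤ (g * (m + fromℕ t)) (neg-antimono-≤
               (0≤* (0≤step l≤h) (+-mono-≤ (<⇒≤ 0<1) (0≤fromℕ t)))) ⟩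
        g * (m + fromℕ t) + 0ℚ
          ≡⟨ +-identityʳ (g * (m + fromℕ t)) ⟩
        g * (m + fromℕ t) ∎) width
        where
        open ≤-Reasoning
        g = h - l
        d = step l h

      -- The ratio at `o` lies in one half of the interval. In the upper half the lower end is
      -- raised; in the lower half the same argument applied to `- z` brings the upper end down.
      tighten : ∀ {u K t} → Bracket u K t → Bracket u K (suc t)
      tighten {u} {K} {t} b with (lo b + S * step (lo b) (hi b)) * w t o ≤? (Q ^ t) u o
      ... | yes mid≤ = record
        { lo    = l + d
        ; hi    = h
        ; lo≤   = raise t z l d (0≤step (lo≤hi b)) (lo≤ b) mid≤
        ; ≤hi   = λ i → ≤-trans (monotone Q⁺ (≤hi b) i) (≤-reflexive (homogeneous Q⁺ h (w t) i))
        ; width = ≤-trans (≤-reflexive (cong (_* (m + fromℕ (suc t)))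
            (solve 3 (λ l h d → h :- (l :+ d) := (h :- l) :- d) refl l h d)))
            (narrow t (lo≤hi b) (width b))
        }
        where
        l = lo b
        h = hi b
        z = (Q ^ t) u
        d = step l h
      ... | no ≰mid = record
        { lo    = l
        ; hi    = h - d
        ; lo≤   = λ i → ≤-trans (≤-reflexive (sym (homogeneous Q⁺ l (w t) i))) (monotone Q⁺ (lo≤ b) i)
        ; ≤hi   = λ i → neg-cancel-≤ (subst₂ _≤_
            (solve 3 (λ h d W → (:- h :+ d) :* W := :- ((h :- d) :* W)) refl h d (w (suc t) i))
            (Q-neg i)
            (raise t (λ j → - 1ℚ * z j) (- h) d (0≤step (lo≤hi b)) -h≤ mid≤ i))
        ; width = ≤-trans (≤-reflexive (cong (_* (m + fromℕ (suc t)))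
            (solve 3 (λ l h d → (h :- d) :- l := (h :- l) :- d) refl l h d)))
            (narrow t (lo≤hi b) (width b))
        }
        where
        l = lo b
        h = hi b
        z = (Q ^ t) u
        d = step l h
        neg-cancel-≤ : ∀ {p q} → - p ≤ - q → q ≤ p
        neg-cancel-≤ {p} {q} -p≤-q = subst₂ _≤_ (neg-involutive q) (neg-involutive p) (neg-antimono-≤ -p≤-q)
          where
          neg-involutive : ∀ p → - (- p) ≡ p
          neg-involutive = solve 1 (λ p → :- (:- p) := p) refl
        -1* : ∀ p → - 1ℚ * p ≡ - p
        -1* = solve 1 (λ p → :- con 1ℚ :* p := :- p) refl
        Q-neg : ∀ i → Q (λ j → - 1ℚ * z j) i ≡ - Q z i
        Q-neg i = trans (homogeneous Q⁺ (- 1ℚ) z i) (-1* (Q z i))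
        -h≤ : ∀ i → - h * w t i ≤ - 1ℚ * z i
        -h≤ i = subst₂ _≤_ (neg-distribˡ-* h (w t i)) (sym (-1* (z i))) (neg-antimono-≤ (≤hi b i))
        -- The midpoint reached from both ends, so that failing the test from below is passing the
        -- reflected test.
        midpoint : l + S * d ≡ h - S * d
        midpoint = trans (cong (l +_) (S*step l h)) (trans
          (solve 2 (λ l h → l :+ (h :- l) :* con ½ := h :- (h :- l) :* con ½) refl l h)
          (cong (λ e → h - e) (sym (S*step l h))))
        mid≤ : (- h + S * d) * w t o ≤ - 1ℚ * z o
        mid≤ = subst₂ _≤_
          (trans (cong (λ e → - (e * w t o)) midpoint)
            (solve 3 (λ h e W → :- ((h :- e) :* W) := (:- h :+ e) :* W) refl h (S * d) (w t o)))
          (sym (-1* (z o)))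
          (neg-antimono-≤ (<⇒≤ (≰⇒> ≰mid)))

    bracket : ∀ u → ∃[ K ] (∀ t → Bracket u K t)
    bracket u = K , go
      where
      abound = upperBound (λ i → ∣ u i ∣)
      B = proj₁ abound
      -- The weighted width of the initial interval from `- B` to `B`, a bound that `tighten`
      -- preserves.
      K = (B - - B) * (m + fromℕ 0)
      ∣u∣≤Bw : ∀ i → ∣ u i ∣ ≤ B * w₀ i
      ∣u∣≤Bw i = ≤-trans (proj₂ (proj₂ abound) i)
        (subst (_≤ B * w₀ i) (*-identityʳ B) (*-monoˡ-≤ (<⇒≤ (proj₁ (proj₂ abound))) (1≤w₀ i)))
      go : ∀ t → Bracket u K t
      go zero    = record
        { lo    = - B
        ; hi    = B
        ; lo≤   = λ i → subst₂ _≤_ (neg-distribˡ-* B (w₀ i)) (solve 1 (λ p → :- (:- p) := p) refl (u i))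
            (neg-antimono-≤ (≤-trans (≤-trans (p≤∣p∣ (- u i)) (≤-reflexive (∣-p∣≡∣p∣ (u i)))) (∣u∣≤Bw i)))
        ; ≤hi   = λ i → ≤-trans (p≤∣p∣ (u i)) (∣u∣≤Bw i)
        ; width = ≤-refl
        }
      go (suc t) = tighten (go t)

    0≤m : 0ℚ ≤ m
    0≤m = +-mono-≤ (<⇒≤ 0<S) (<⇒≤ 0<S)

    w⁻¹ : ℕ → ℚ
    w⁻¹ t = proj₁ (1/-pos (w t o) (0<w t o))

    -- Approximates the left Perron eigenvector of `Q` as a functional, normalised to take the value
    -- 1 on `w₀`. Linearity and monotonicity hold at each `t`, not only in the limit.
    φ : ℕ → Vector n → ℚ
    φ t u = (Q ^ t) u o * w⁻¹ t

    private
      0≤w⁻¹ : ∀ t → 0ℚ ≤ w⁻¹ t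
      0≤w⁻¹ t = <⇒≤ (proj₁ (proj₂ (1/-pos (w t o) (0<w t o))))

      cancel-w : ∀ t l → (l * w t o) * w⁻¹ t ≡ l
      cancel-w t l = trans (*-assoc l (w t o) (w⁻¹ t))
        (trans (cong (l *_) (proj₂ (proj₂ (1/-pos (w t o) (0<w t o))))) (*-identityʳ l))

      ≤-divide : ∀ t {l z} → l * w t o ≤ z → l ≤ z * w⁻¹ t
      ≤-divide t {l} {z} h = subst (_≤ z * w⁻¹ t) (cancel-w t l) (*-monoʳ-≤ (0≤w⁻¹ t) h)

      divide-≤ : ∀ t {h z} → z ≤ h * w t o → z * w⁻¹ t ≤ h
      divide-≤ t {h} {z} z≤ = subst (z * w⁻¹ t ≤_) (cancel-w t h) (*-monoʳ-≤ (0≤w⁻¹ t) z≤)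

      lo≤-later : ∀ {u K t} (b : Bracket u K t) r i → lo b * w (r ℕ.+ t) i ≤ (Q ^ (r ℕ.+ t)) u i
      lo≤-later         b zero    i = lo≤ b i
      lo≤-later {t = t} b (suc r) i = ≤-trans
        (≤-reflexive (sym (homogeneous Q⁺ (lo b) (w (r ℕ.+ t)) i))) (monotone Q⁺ (lo≤-later b r) i)

      ≤hi-later : ∀ {u K t} (b : Bracket u K t) r i → (Q ^ (r ℕ.+ t)) u i ≤ hi b * w (r ℕ.+ t) i
      ≤hi-later         b zero    i = ≤hi b i
      ≤hi-later {t = t} b (suc r) i = ≤-trans
        (monotone Q⁺ (≤hi-later b r) i) (≤-reflexive (homogeneous Q⁺ (hi b) (w (r ℕ.+ t)) i))

    lo≤φ : ∀ {u K t} (b : Bracket u K t) {s} → t ℕ.≤ s → lo b ≤ φ s u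
    lo≤φ {u} {t = t} b {s} t≤s = subst (λ s → lo b ≤ φ s u) (ℕ.m∸n+n≡m t≤s)
      (≤-divide (s ℕ.∸ t ℕ.+ t) (lo≤-later b (s ℕ.∸ t) o))

    φ≤hi : ∀ {u K t} (b : Bracket u K t) {s} → t ℕ.≤ s → φ s u ≤ hi b
    φ≤hi {u} {t = t} b {s} t≤s = subst (λ s → φ s u ≤ hi b) (ℕ.m∸n+n≡m t≤s)
      (divide-≤ (s ℕ.∸ t ℕ.+ t) (≤hi-later b (s ℕ.∸ t) o))

    -- Positivity of `Q` keeps all later ratios inside the bracket at `N`, so the width of that
    -- bracket serves as a modulus.
    φ-cauchy : ∀ u → Cauchy (λ t → φ t u)
    φ-cauchy u ε 0<ε with bracket u
    ... | K , b with decay m K ε 0≤m 0<ε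
    ...   | N , h = N , λ s t N≤s N≤t → ≤-<-trans
      (∣p-q∣≤width (lo≤φ (b N) N≤s) (φ≤hi (b N) N≤s) (lo≤φ (b N) N≤t) (φ≤hi (b N) N≤t))
      (h N ℕ.≤-refl (hi (b N) - lo (b N)) (width (b N)))

    ≤φ : ∀ t {c u} → (∀ i → c * w₀ i ≤ u i) → c ≤ φ t u
    ≤φ t {c} {u} c≤u = ≤-divide t (≤-trans (≤-reflexive (sym (homogeneous (positive-^ Q⁺ t) c w₀ o)))
      (monotone (positive-^ Q⁺ t) c≤u o))

    φ≤ : ∀ t {c u} → (∀ i → u i ≤ c * w₀ i) → φ t u ≤ c
    φ≤ t {c} {u} u≤c = divide-≤ t (≤-trans (monotone (positive-^ Q⁺ t) u≤c o)
      (≤-reflexive (homogeneous (positive-^ Q⁺ t) c w₀ o)))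

    φ-cong : ∀ t {u v} → (∀ i → u i ≡ v i) → φ t u ≡ φ t v
    φ-cong t u≡v = cong (_* w⁻¹ t) (congruent (positive-^ Q⁺ t) u≡v o)

    φ-sum : ∀ t {k} (c : Fin k → ℚ) (u : Fin k → Vector n) →
      φ t (λ j → sum (λ i → c i * u i j)) ≡ sum (λ i → c i * φ t (u i))
    φ-sum t c u = begin
      (Q ^ t) (λ j → sum (λ i → c i * u i j)) o * w⁻¹ t
        ≡⟨ cong (_* w⁻¹ t) (sum-preserving (positive-^ Q⁺ t) c u o) ⟩
      sum (λ i → c i * (Q ^ t) (u i) o) * w⁻¹ t
        ≡⟨ *-distribʳ-sum (w⁻¹ t) (λ i → c i * (Q ^ t) (u i) o) ⟩
      sum (λ i → c i * (Q ^ t) (u i) o * w⁻¹ t)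
        ≡⟨ sum-cong-≗ (λ i → *-assoc (c i) ((Q ^ t) (u i) o) (w⁻¹ t)) ⟩
      sum (λ i → c i * φ t (u i)) ∎
      where open ≡-Reasoning

    -- Since `T` commutes with `Q ^ t`, applying it to the bracket of `u` and dividing at `o` puts
    -- `φ t (T u)` between `φ t (T w₀)` times `lo` and times `hi`. The product `φ t (T w₀) * φ t u`
    -- lies in the same interval, whose length is at most `r` times that of the bracket.
    φ-eigen : ∀ {T : Operator n} → Positive T → (∀ z → Q (T z) ≡ T (Q z)) →
      ∀ u → Null (λ t → φ t (T u) - φ t (T w₀) * φ t u)
    φ-eigen {T} T⁺ QT≡TQ u ε 0<ε with bracket u | upperBound (T w₀)
    ... | K , b | r , 0<r , Tw₀≤r with decay m (r * K) ε 0≤m 0<ε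
    ...   | N , h = N , λ t N≤t → ≤-<-trans
      (∣p-q∣≤width (lo-λ≤ t) (≤hi-λ t)
        (*-mono-λ t (lo≤φ (b t) ℕ.≤-refl)) (*-mono-λ t (φ≤hi (b t) ℕ.≤-refl)))
      (h t N≤t (eigenvalue t * hi (b t) - eigenvalue t * lo (b t)) (shrink t))
      where
      eigenvalue : ℕ → ℚ
      eigenvalue t = φ t (T w₀)
      0≤λ : ∀ t → 0ℚ ≤ eigenvalue t
      0≤λ t = ≤φ t (λ i → ≤-trans (≤-reflexive (*-zeroˡ (w₀ i))) (nonNegative-preserving T⁺ 0≤w₀ i))
      λ≤r : ∀ t → eigenvalue t ≤ r
      λ≤r t = φ≤ t (λ i → ≤-trans (Tw₀≤r i)
        (subst (_≤ r * w₀ i) (*-identityʳ r) (*-monoˡ-≤ (<⇒≤ 0<r) (1≤w₀ i))))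
      *-mono-λ : ∀ t {p q} → p ≤ q → eigenvalue t * p ≤ eigenvalue t * q
      *-mono-λ t = *-monoˡ-≤ (0≤λ t)
      commute : ∀ t z → (Q ^ t) (T z) o ≡ T ((Q ^ t) z) o
      commute t z = cong (λ f → f o) (^-commute QT≡TQ t z)
      λ* : ∀ t c → eigenvalue t * c ≡ T (λ i → c * w t i) o * w⁻¹ t
      λ* t c = begin
        (Q ^ t) (T w₀) o * w⁻¹ t * c      ≡⟨ cong (λ p → p * w⁻¹ t * c) (commute t w₀) ⟩
        T (w t) o * w⁻¹ t * c             ≡⟨ solve 3 (λ a b c → a :* b :* c := c :* a :* b) refl
                                               (T (w t) o) (w⁻¹ t) c ⟩
        c * T (w t) o * w⁻¹ t             ≡⟨ cong (_* w⁻¹ t) (sym (homogeneous T⁺ c (w t) o)) ⟩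
        T (λ i → c * w t i) o * w⁻¹ t     ∎
        where open ≡-Reasoning
      φT≡ : ∀ t → φ t (T u) ≡ T ((Q ^ t) u) o * w⁻¹ t
      φT≡ t = cong (_* w⁻¹ t) (commute t u)
      lo-λ≤ : ∀ t → eigenvalue t * lo (b t) ≤ φ t (T u)
      lo-λ≤ t = subst₂ _≤_ (sym (λ* t (lo (b t)))) (sym (φT≡ t))
        (*-monoʳ-≤ (0≤w⁻¹ t) (monotone T⁺ (lo≤ (b t)) o))
      ≤hi-λ : ∀ t → φ t (T u) ≤ eigenvalue t * hi (b t)
      ≤hi-λ t = subst₂ _≤_ (sym (φT≡ t)) (sym (λ* t (hi (b t))))
        (*-monoʳ-≤ (0≤w⁻¹ t) (monotone T⁺ (≤hi (b t)) o))
      shrink : ∀ t → (eigenvalue t * hi (b t) - eigenvalue t * lo (b t)) * (m + fromℕ t) ≤ r * K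
      shrink t = begin
        (eigenvalue t * hi (b t) - eigenvalue t * lo (b t)) * (m + fromℕ t)
          ≡⟨ solve 4 (λ e h l f → (e :* h :- e :* l) :* f := e :* ((h :- l) :* f)) refl
               (eigenvalue t) (hi (b t)) (lo (b t)) (m + fromℕ t) ⟩
        eigenvalue t * ((hi (b t) - lo (b t)) * (m + fromℕ t))
          ≤⟨ *-monoʳ-≤ (0≤* (p≤q⇒0≤q-p (lo≤hi (b t))) (+-mono-≤ 0≤m (0≤fromℕ t))) (λ≤r t) ⟩
        r * ((hi (b t) - lo (b t)) * (m + fromℕ t))
          ≤⟨ *-monoˡ-≤ (<⇒≤ 0<r) (width (b t)) ⟩
        r * K ∎
        where open ≤-Reasoning

-- Perron eigenpairs of irreducible nonnegative Gram matrices.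

module PerronFrobenius where

  open RationalSums
  open NullSequences
  open PositiveOperators
  open import Data.Fin.Base using (Fin; zero; suc)
  open import Data.Nat.Base as ℕ using (ℕ; zero; suc)
  import Data.Nat.Properties as ℕ
  open import Data.Product.Base using (∃-syntax; Σ-syntax; _×_; _,_; proj₁; proj₂)
  open import Data.Rational.Base hiding (Positive; NonNegative)
  open import Data.Rational.Properties
  open import Data.Rational.Solver using (module +-*-Solver)
  open import Relation.Binary.Construct.Closure.ReflexiveTransitive using (Star; ε; _◅_)
  open import Relation.Binary.PropositionalEquality
  open import Relation.Nullary.Negation using (¬_)
  open +-*-Solver using (solve; _:=_; _:*_)

  infixr 7 _⊛_

  _⊛_ : ∀ {m n} → (Fin m → Fin n → ℚ) → Vector n → Vector m
  (A ⊛ z) i = sum (λ j → A i j * z j)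

  ⊛-positive : ∀ {n} {A : Fin n → Fin n → ℚ} → (∀ i j → 0ℚ ≤ A i j) → Positive (A ⊛_)
  ⊛-positive {n} {A} 0≤A = record
    { monotone    = λ a≤b i → sum-mono (λ j → *-monoˡ-≤ (0≤A i j) (a≤b j))
    ; additive    = λ a b i → trans (sum-cong-≗ (λ j → *-distribˡ-+ (A i j) (a j) (b j)))
        (∑-distrib-+ (λ j → A i j * a j) (λ j → A i j * b j))
    ; homogeneous = λ c a i → trans
        (sum-cong-≗ (λ j → solve 3 (λ A c a → A :* (c :* a) := c :* (A :* a)) refl (A i j) c (a j)))
        (sym (*-distribˡ-sum c (λ j → A i j * a j)))
    }

  -- For a nonnegative matrix this says that the entry of its `d`-th power at `i`, `j` is at least
  -- 1; in this form powers never need entries.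
  Reaches : ∀ {n} → Operator n → Fin n → Fin n → ℕ → Set
  Reaches T i j d = ∀ {z} → NonNegative z → z j ≤ (T ^ d) z i

  module _ {n} {A : Fin n → Fin n → ℚ} (0≤A : ∀ i j → 0ℚ ≤ A i j) where

    entry-≤ : ∀ {i j z} → 1ℚ ≤ A i j → NonNegative z → z j ≤ (A ⊛ z) i
    entry-≤ {i} {j} {z} 1≤A 0≤z = begin
      z j             ≡⟨ sym (*-identityˡ (z j)) ⟩
      1ℚ * z j        ≤⟨ *-monoʳ-≤ (0≤z j) 1≤A ⟩
      A i j * z j     ≤⟨ term≤sum (λ l → 0≤* (0≤A i l) (0≤z l)) j ⟩
      (A ⊛ z) i       ∎
      where open ≤-Reasoning

    reaches-star : ∀ {i j} → Star (λ i j → 1ℚ ≤ A i j) i j → ∃[ d ] Reaches (A ⊛_) i j d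
    reaches-star ε             = 0 , λ _ → ≤-refl
    reaches-star (1≤A ◅ walk) with reaches-star walk
    ... | d , h = suc d , λ 0≤z → ≤-trans (h 0≤z)
      (entry-≤ 1≤A (nonNegative-preserving (positive-^ (⊛-positive 0≤A) d) 0≤z))

    -- A diagonal entry of at least 1 lets a walk wait at `i`, so walks of different lengths can be
    -- brought to a common length.
    reaches-later : (∀ i → 1ℚ ≤ A i i) → ∀ {i j d e} → d ℕ.≤ e →
      Reaches (A ⊛_) i j d → Reaches (A ⊛_) i j e
    reaches-later 1≤Aᵢᵢ {i} {j} {d} {e} d≤e h = subst (Reaches (A ⊛_) i j) (ℕ.m∸n+n≡m d≤e) (go (e ℕ.∸ d))
      where
      go : ∀ r → Reaches (A ⊛_) i j (r ℕ.+ d)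
      go zero    = h
      go (suc r) 0≤z = ≤-trans (go r 0≤z)
        (entry-≤ (1≤Aᵢᵢ i) (nonNegative-preserving (positive-^ (⊛-positive 0≤A) (r ℕ.+ d)) 0≤z))

  uniform : ∀ {n} (P : Fin n → ℕ → Set) → (∀ i {d e} → d ℕ.≤ e → P i d → P i e) →
    (∀ i → ∃[ d ] P i d) → ∃[ d ] (∀ i → P i d)
  uniform {zero}  P later h = 0 , λ ()
  uniform {suc n} P later h with h zero | uniform (λ i → P (suc i)) (λ i → later (suc i)) (λ i → h (suc i))
  ... | d , p | e , q = d ℕ.⊔ e , λ
    { zero → later zero (ℕ.m≤m⊔n d e) p ; (suc i) → later (suc i) (ℕ.m≤n⊔m d e) (q i) }

  gram : ∀ {r n} → (Fin r → Fin n → ℚ) → Fin n → Fin n → ℚ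
  gram C i j = sum (λ σ → C σ i * C σ j)

  -- Writes `CᵀC a` as a combination of the rows of `C`, so that a linear functional on it is
  -- determined by its values on the rows.
  gram-⊛ : ∀ {r n} (C : Fin r → Fin n → ℚ) (a : Vector n) j →
    sum (λ σ → sum (λ i → a i * C σ i) * C σ j) ≡ (gram C ⊛ a) j
  gram-⊛ C a j = begin
    sum (λ σ → sum (λ i → a i * C σ i) * C σ j)
      ≡⟨ sum-cong-≗ (λ σ → *-distribʳ-sum (C σ j) (λ i → a i * C σ i)) ⟩
    sum (λ σ → sum (λ i → a i * C σ i * C σ j))
      ≡⟨ ∑-comm (λ σ i → a i * C σ i * C σ j) ⟩
    sum (λ i → sum (λ σ → a i * C σ i * C σ j))
      ≡⟨ sum-cong-≗ (λ i → trans
           (sum-cong-≗ (λ σ → solve 3 (λ a c d → a :* c :* d := d :* c :* a) refl (a i) (C σ i) (C σ j)))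
           (sym (*-distribʳ-sum (a i) (λ σ → C σ j * C σ i)))) ⟩
    (gram C ⊛ a) j ∎
    where open ≡-Reasoning

  -- A positive T with T χ ≥ μ χ + e, where χ and e are nonnegative and nonzero, has Perron root
  -- above μ: pushing the inequality forward by Q ² makes e strictly positive. The Perron vector
  -- is the functional φ, here applied to the rows of C.
  module StrictSubsolution {r n} {T Q : Operator n} (T⁺ : Positive T) (Q⁺ : Positive Q)
    (QT≡TQ : ∀ z → Q (T z) ≡ T (Q z)) {o : Fin n}
    (spread : ∀ {z} → NonNegative z → ∀ i → z o ≤ Q z i)
    (gather : ∀ {z} → NonNegative z → ∀ i → z i ≤ Q z o)
    (C : Fin r → Vector n)
    (T≡CᵀC : ∀ a j → sum (λ σ → sum (λ i → a i * C σ i) * C σ j) ≡ T a j)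
    {μ : ℚ} {χ e : Vector n} {f : Fin n} (0≤μ : 0ℚ ≤ μ)
    (0≤χ : NonNegative χ) (1≤χo : 1ℚ ≤ χ o) (0≤e : NonNegative e) (1≤ef : 1ℚ ≤ e f)
    (sub : ∀ i → μ * χ i + e i ≤ T χ i) where

    private
      w₀ : Vector n
      -- Two applications, because the mass of `e` travels from `f` to `o` and then from `o` to
      -- every coordinate; `χ` has to be pushed by the same power.
      w₀ = Q (Q χ)

      1≤w₀ : ∀ i → 1ℚ ≤ w₀ i
      1≤w₀ i = ≤-trans 1≤χo (≤-trans (spread 0≤χ o) (spread (nonNegative-preserving Q⁺ 0≤χ) i))

      1≤QQe : ∀ i → 1ℚ ≤ Q (Q e) i
      1≤QQe i = ≤-trans 1≤ef (≤-trans (gather 0≤e f) (spread (nonNegative-preserving Q⁺ 0≤e) i))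

      push : ∀ a b → (∀ i → μ * a i + b i ≤ T a i) → ∀ i → μ * Q a i + Q b i ≤ T (Q a) i
      push a b h i = subst₂ _≤_
        (trans (additive Q⁺ (λ j → μ * a j) b i) (cong (_+ Q b i) (homogeneous Q⁺ μ a i)))
        (cong (λ z → z i) (QT≡TQ a)) (monotone Q⁺ h i)

      strict : ∃[ β ] (μ < β × (∀ i → β * w₀ i ≤ T w₀ i))
      strict with upperBound w₀
      -- The margin `η` is `1/R`, so that `η w₀` is at most 1 and is paid for by `Q (Q e)`.
      ... | R , 0<R , w₀≤R with 1/-pos R 0<R
      ...   | η , 0<η , Rη≡1 = μ + η
        , subst (_< μ + η) (+-identityʳ μ) (+-monoʳ-< μ 0<η)
        , λ i → begin
          (μ + η) * w₀ i          ≡⟨ *-distribʳ-+ (w₀ i) μ η ⟩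
          μ * w₀ i + η * w₀ i     ≤⟨ +-monoʳ-≤ (μ * w₀ i) (*-monoˡ-≤ (<⇒≤ 0<η) (w₀≤R i)) ⟩
          μ * w₀ i + η * R        ≡⟨ cong (μ * w₀ i +_) (trans (*-comm η R) Rη≡1) ⟩
          μ * w₀ i + 1ℚ           ≤⟨ +-monoʳ-≤ (μ * w₀ i) (1≤QQe i) ⟩
          μ * w₀ i + Q (Q e) i    ≤⟨ push (Q χ) (Q e) (push χ e sub) i ⟩
          T w₀ i                  ∎
        where open ≤-Reasoning

    open Contraction Q⁺ o spread gather {w₀} 1≤w₀

    -- Because `φ` takes the value 1 on `w₀`, its value on `T w₀` is the factor by which `T` scales
    -- `φ`.
    perronRoot : ℝ
    perronRoot = mkℝ (λ t → φ t (T w₀)) (φ-cauchy (T w₀))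

    -- If `φ` is the pairing with an eigenvector `x` of `CᵀC`, then this is `C x`, an eigenvector of
    -- `CCᵀ` for the same eigenvalue.
    perronVector : Fin r → ℝ
    perronVector σ = mkℝ (λ t → φ t (C σ)) (φ-cauchy (C σ))

    perronRoot-bound : ∃[ β ] (μ < β × (∀ t → β ≤ seq perronRoot t))
    perronRoot-bound with strict
    ... | β , μ<β , βw₀≤Tw₀ = β , μ<β , λ t → ≤φ t βw₀≤Tw₀

    private
      φ-gram : ∀ t a → sum (λ σ → sum (λ i → a i * C σ i) * φ t (C σ)) ≡ φ t (T a)
      φ-gram t a = trans (sym (φ-sum t (λ σ → sum (λ i → a i * C σ i)) C)) (φ-cong t (T≡CᵀC a))

    private
      term : Fin r → ℕ → ℚ
      term σ t = sum (λ i → w₀ i * C σ i) * seq (perronVector σ) t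

      vector-null⇒root-null : (∀ σ → Null (seq (perronVector σ))) → Null (seq perronRoot)
      vector-null⇒root-null v≈0 = null-cong {x = λ t → sum (λ σ → term σ t)} (λ t → φ-gram t w₀)
        (null-sum {x = term} (λ σ → null-scale (sum (λ i → w₀ i * C σ i)) {seq (perronVector σ)} (v≈0 σ)))

    -- The root is a fixed rational combination of the entries of the vector. Were they all to
    -- vanish, so would the root, which stays above the positive `β`.
    perronVector≢0 : ¬ (∀ σ → Null (seq (perronVector σ)))
    perronVector≢0 v≈0 = contradict perronRoot-bound
      where
      contradict : ¬ (∃[ β ] (μ < β × (∀ t → β ≤ seq perronRoot t)))
      contradict (β , μ<β , β≤ν) = <-irrefl refl (≤-<-trans
        (≤-trans (β≤ν N) (p≤∣p∣ (seq perronRoot N))) (proj₂ small N ℕ.≤-refl))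
        where
        small = vector-null⇒root-null v≈0 β (≤-<-trans 0≤μ μ<β)
        N = proj₁ small

    perron-eigen : ∀ σ → Null (λ t →
      sum (λ τ → sum (λ i → C σ i * C τ i) * seq (perronVector τ) t)
        - seq perronRoot t * seq (perronVector σ) t)
    perron-eigen σ = null-cong {x = λ t → φ t (T (C σ)) - seq perronRoot t * seq (perronVector σ) t}
      (λ t → cong (_- seq perronRoot t * seq (perronVector σ) t) (sym (φ-gram t (C σ))))
      (φ-eigen T⁺ QT≡TQ (C σ))

  -- Supplies `spread` and `gather` for `Q`: for each `i` the sum of the walk lengths to and from
  -- `o` serves both directions, and the maximum over `i` serves all.
  connected⇒power : ∀ {n} {A : Fin n → Fin n → ℚ} → (∀ i j → 0ℚ ≤ A i j) → (∀ i → 1ℚ ≤ A i i) →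
    (∀ i j → Star (λ i j → 1ℚ ≤ A i j) i j) → ∀ o →
    ∃[ p ] (∀ i → Reaches (A ⊛_) i o p × Reaches (A ⊛_) o i p)
  connected⇒power {A = A} 0≤A 1≤Aᵢᵢ connected o =
    uniform (λ i d → Reaches (A ⊛_) i o d × Reaches (A ⊛_) o i d)
      (λ i d≤e (to , from) → later d≤e to , later d≤e from)
      (λ i → let a , to   = reaches-star 0≤A (connected i o)
                 b , from = reaches-star 0≤A (connected o i)
             in a ℕ.+ b , later (ℕ.m≤m+n a b) to , later (ℕ.m≤n+m b a) from)
    where
    later : ∀ {i j d e} → d ℕ.≤ e → Reaches (A ⊛_) i j d → Reaches (A ⊛_) i j e
    later = reaches-later 0≤A 1≤Aᵢᵢ

  -- The rational margin `β` below every term of the sequence witnesses the strict inequality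
  -- between reals.
  ExceedingEigenpair : ∀ {r n} → (Fin r → Fin n → ℚ) → ℚ → Set
  ExceedingEigenpair {r} C μ = Σ[ ν ∈ ℝ ] Σ[ v ∈ (Fin r → ℝ) ]
    (∃[ β ] (μ < β × (∀ t → β ≤ seq ν t))) ×
    ¬ (∀ σ → Null (seq (v σ))) ×
    (∀ σ → Null (λ t →
      sum (λ τ → sum (λ i → C σ i * C τ i) * seq (v τ) t) - seq ν t * seq (v σ) t))

  exceeding-eigenpair : ∀ {r n} (C : Fin r → Fin n → ℚ) →
    (∀ i j → 0ℚ ≤ gram C i j) → (∀ i → 1ℚ ≤ gram C i i) →
    (∀ i j → Star (λ i j → 1ℚ ≤ gram C i j) i j) →
    ∀ {μ} {χ e : Vector n} {o f} → 0ℚ ≤ μ → NonNegative χ → 1ℚ ≤ χ o → NonNegative e → 1ℚ ≤ e f →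
    (∀ i → μ * χ i + e i ≤ (gram C ⊛ χ) i) → ExceedingEigenpair C μ
  exceeding-eigenpair {r} {n} C 0≤A 1≤Aᵢᵢ connected {μ} {χ} {e} {o} {f} 0≤μ 0≤χ 1≤χo 0≤e 1≤ef sub =
    go (connected⇒power 0≤A 1≤Aᵢᵢ connected o)
    where
    go : ∃[ p ] (∀ i → Reaches (gram C ⊛_) i o p × Reaches (gram C ⊛_) o i p) → ExceedingEigenpair C μ
    go (p , reach) = P.perronRoot , P.perronVector , P.perronRoot-bound , P.perronVector≢0 , P.perron-eigen
      where
      T⁺ = ⊛-positive 0≤A
      module P = StrictSubsolution T⁺ (positive-^ T⁺ p) (^-commute {T = gram C ⊛_} (λ _ → refl) p)
        {o} (λ 0≤z i → proj₁ (reach i) 0≤z) (λ 0≤z i → proj₂ (reach i) 0≤z)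
        C (gram-⊛ C) {μ} {χ} {e} {f} 0≤μ 0≤χ 1≤χo 0≤e 1≤ef sub

-- Real eigenvalues of a product of a matrix with its transpose.

module Spectrum where

  open RationalSums
  open NullSequences
  open PositiveOperators using (Vector)
  open PerronFrobenius
  import Algebra.Definitions.RawMonoid as RawMonoid
  open import Data.Empty using (⊥-elim)
  open import Data.Fin.Base using (Fin; zero; suc)
  open import Data.Integer.Base as ℤ using (ℤ; +_)
  import Data.Integer.Properties as ℤ
  open import Data.Nat.Base as ℕ using (ℕ; zero; suc)
  import Data.Nat.Properties as ℕ
  open import Data.Product.Base using (∃-syntax; _,_; proj₁; proj₂)
  open import Data.Rational.Base
  open import Data.Rational.Properties
  open import Data.Rational.Solver using (module +-*-Solver)
  open import Relation.Binary.PropositionalEquality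
  open import Relation.Nullary.Decidable using (Dec; yes; no)
  open import Relation.Nullary.Negation using (¬_)
  open +-*-Solver using (solve; _:=_; _:+_; _:*_; _:-_; :-_; con)

  sumℤ : ∀ {n} → (Fin n → ℤ) → ℤ
  sumℤ = RawMonoid.sum ℤ.+-0-rawMonoid

  ι-sum : ∀ {n} (f : Fin n → ℤ) → ι (sumℤ f) ≡ sum (λ i → ι (f i))
  ι-sum {zero}  f = refl
  ι-sum {suc n} f = trans (ι-+ (f zero) (sumℤ (λ i → f (suc i)))) (cong (_+_ (ι (f zero))) (ι-sum (λ i → f (suc i))))

  seq-sum : ∀ {n} (f : Fin n → ℝ) t → seq (RawMonoid.sum ℝ-+-rawMonoid f) t ≡ sum (λ i → seq (f i) t)
  seq-sum {zero}  f t = refl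
  seq-sum {suc n} f t = cong (_+_ (seq (f zero) t)) (seq-sum (λ i → f (suc i)) t)

  ≈0⇒null : ∀ x → x ≈ 0ᵣ → Null (seq x)
  ≈0⇒null x = null-cong (λ t → +-identityʳ (seq x t))

  null⇒≈0 : ∀ x → Null (seq x) → x ≈ 0ᵣ
  null⇒≈0 x = null-cong (λ t → sym (+-identityʳ (seq x t)))

  -- ≤ᵣ is stable under double negation: the modulus of ν reduces it to comparing two rationals.
  ≤ᵣ-intro : ∀ ν p → (∀ {δ} → 0ℚ < δ → ∀ M → ¬ (∀ t → M ℕ.≤ t → p + δ ≤ seq ν t)) → ν ≤ᵣ fromℚ p
  ≤ᵣ-intro ν p ¬far ε 0<ε = M , λ t M≤t → bound t M≤t (seq ν M <? p + (δ + δ))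
    where
    -- A quarter of `ε`: two parts for the comparison at `M`, one for the fluctuation after `M`, one
    -- to spare. If the comparison fails, the fluctuation still leaves `ν` at least `δ` above `p`.
    δ = ε * ½ * ½
    0<δ : 0ℚ < δ
    0<δ = half (half 0<ε)
    modulus = cauchy ν δ 0<δ
    M = proj₁ modulus
    close : ∀ t → M ℕ.≤ t → ∣ seq ν M - seq ν t ∣ < δ
    close t M≤t = proj₂ modulus M t ℕ.≤-refl M≤t
    bound : ∀ t → M ℕ.≤ t → Dec (seq ν M < p + (δ + δ)) → seq ν t < p + ε
    bound t M≤t (yes νM<) = begin-strict
      seq ν t
        ≡⟨ solve 2 (λ a b → a := b :+ :- (b :- a)) refl (seq ν t) (seq ν M) ⟩
      seq ν M + - (seq ν M - seq ν t)
        ≤⟨ +-monoʳ-≤ (seq ν M) (≤-trans (p≤∣p∣ (- (seq ν M - seq ν t)))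
             (≤-trans (≤-reflexive (∣-p∣≡∣p∣ (seq ν M - seq ν t))) (<⇒≤ (close t M≤t)))) ⟩
      seq ν M + δ
        <⟨ +-monoˡ-< δ νM< ⟩
      p + (δ + δ) + δ
        ≤⟨ ≤-trans (≤-reflexive (sym (+-identityʳ (p + (δ + δ) + δ)))) (+-monoʳ-≤ (p + (δ + δ) + δ) (<⇒≤ 0<δ)) ⟩
      p + (δ + δ) + δ + δ
        ≡⟨ solve 2 (λ p e → p :+ (e :* con ½ :* con ½ :+ e :* con ½ :* con ½) :+ e :* con ½ :* con ½ :+ e :* con ½ :* con ½
             := p :+ e) refl p ε ⟩
      p + ε ∎
      where open ≤-Reasoning
    bound t M≤t (no νM≮) = ⊥-elim (¬far 0<δ M λ u M≤u → begin
      p + δ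
        ≡⟨ solve 2 (λ p d → p :+ d := p :+ (d :+ d) :- d) refl p δ ⟩
      p + (δ + δ) - δ
        ≤⟨ +-mono-≤ (≮⇒≥ νM≮) (neg-antimono-≤ (≤-trans (p≤∣p∣ (seq ν M - seq ν u)) (<⇒≤ (close u M≤u)))) ⟩
      seq ν M - (seq ν M - seq ν u)
        ≡⟨ solve 2 (λ a b → a :- (a :- b) := b) refl (seq ν M) (seq ν u) ⟩
      seq ν u ∎)
      where open ≤-Reasoning

  module _ {r n} (C : Fin r → Fin n → ℤ) (L : Matrix ℤ r r)
    (L≡CCᵀ : ∀ σ τ → L σ τ ≡ sumℤ (λ i → C σ i ℤ.* C τ i)) where

    Ĉ : Fin r → Vector n
    Ĉ σ i = ι (C σ i)

    ι-L : ∀ σ τ → ι (L σ τ) ≡ sum (λ i → Ĉ σ i * Ĉ τ i)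
    ι-L σ τ = trans (cong ι (L≡CCᵀ σ τ)) (trans (ι-sum (λ i → C σ i ℤ.* C τ i))
      (sum-cong-≗ (λ i → ι-* (C σ i) (C τ i))))

    seq-L : ∀ v σ t → seq ((real L ·ᵥ v) σ) t ≡ sum (λ τ → sum (λ i → Ĉ σ i * Ĉ τ i) * seq (v τ) t)
    seq-L v σ t = trans (seq-sum (λ τ → real L σ τ *ᵣ v τ) t)
      (sum-cong-≗ (λ τ → cong (_* seq (v τ) t) (ι-L σ τ)))

    exceeding⇒not-largest : ∀ {μ} → ExceedingEigenpair Ĉ (ι μ) → ¬ IsLargestEigenvalue (real L) (fromℤ μ)
    exceeding⇒not-largest {μ} (ν , v , (β , μ<β , β≤ν) , v≢0 , eigen) (_ , largest) =
      <-irrefl refl (<-≤-trans (subst (seq ν N <_)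
        (solve 2 (λ μ β → μ :+ (β :- μ) := β) refl (ι μ) β) (proj₂ ν≤μ N ℕ.≤-refl)) (β≤ν N))
      where
      isEigenvalue : IsEigenvalue (real L) ν
      isEigenvalue = v , (λ v≈0 → v≢0 (λ σ → ≈0⇒null (v σ) (v≈0 σ))) , λ σ →
        null-cong {x = λ t → sum (λ τ → sum (λ i → Ĉ σ i * Ĉ τ i) * seq (v τ) t) - seq ν t * seq (v σ) t}
          (λ t → cong (_- seq ν t * seq (v σ) t) (sym (seq-L v σ t))) (eigen σ)
      0<β-μ : 0ℚ < β - ι μ
      0<β-μ = subst (_< β - ι μ) (+-inverseʳ (ι μ)) (+-monoˡ-< (- ι μ) μ<β)
      -- With tolerance `β - μ` the upper bound on `ν` becomes `β` itself, which lies below every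
      -- term.
      ν≤μ = largest ν isEigenvalue (β - ι μ) 0<β-μ
      N = proj₁ ν≤μ

    module CompleteGram (κ : ℚ) (0≤κ : 0ℚ ≤ κ) (i₀ : Fin n)
      (gram-⊛≡ : ∀ z i → (gram Ĉ ⊛ z) i ≡ κ * z i + sum z) where

      ones : Vector n
      ones _ = 1ℚ

      N̂ : ℚ
      N̂ = sum ones

      1≤N̂ : 1ℚ ≤ N̂
      1≤N̂ = term≤sum {f = ones} (λ _ → <⇒≤ 0<1) i₀

      sum-gram : ∀ z → sum (gram Ĉ ⊛ z) ≡ (κ + N̂) * sum z
      sum-gram z = begin
        sum (gram Ĉ ⊛ z)
          ≡⟨ sum-cong-≗ (λ i → trans (gram-⊛≡ z i) (cong (_+_ (κ * z i)) (sym (*-identityˡ (sum z))))) ⟩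
        sum (λ i → κ * z i + 1ℚ * sum z)
          ≡⟨ ∑-distrib-+ (λ i → κ * z i) (λ _ → 1ℚ * sum z) ⟩
        sum (λ i → κ * z i) + sum (λ i → ones i * sum z)
          ≡⟨ cong₂ _+_ (sym (*-distribˡ-sum κ z)) (sym (*-distribʳ-sum (sum z) ones)) ⟩
        κ * sum z + N̂ * sum z
          ≡⟨ sym (*-distribʳ-+ (sum z) κ N̂) ⟩
        (κ + N̂) * sum z ∎
        where open ≡-Reasoning

      module _ (μ : ℤ) (ιμ≡ : ι μ ≡ κ + N̂) where

        -- The all-ones vector is the top eigenvector of `κ I + J`, and its image under `C` is the
        -- eigenvector here. That image is nonzero because `Cᵀ` takes it to a vector with entry
        -- `κ + N̂` at `i₀`.
        isEigenvalue : IsEigenvalue (real L) (fromℤ μ)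
        isEigenvalue = v , v≢0 , λ σ → null-cong {x = λ _ → 0ℚ}
            (λ t → sym (trans (cong (_- ι μ * sum (Ĉ σ)) (eq σ t)) (+-inverseʳ (ι μ * sum (Ĉ σ))))) null-0
          where
          v : Fin r → ℝ
          v σ = fromℚ (sum (Ĉ σ))
          eq : ∀ σ t → seq ((real L ·ᵥ v) σ) t ≡ ι μ * sum (Ĉ σ)
          eq σ t = begin
            seq ((real L ·ᵥ v) σ) t
              ≡⟨ seq-L v σ t ⟩
            sum (λ τ → sum (λ i → Ĉ σ i * Ĉ τ i) * sum (Ĉ τ))
              ≡⟨ sum-cong-≗ (λ τ → *-distribˡ-sum (sum (λ i → Ĉ σ i * Ĉ τ i)) (Ĉ τ)) ⟩
            sum (λ τ → sum (λ j → sum (λ i → Ĉ σ i * Ĉ τ i) * Ĉ τ j))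
              ≡⟨ ∑-comm (λ τ j → sum (λ i → Ĉ σ i * Ĉ τ i) * Ĉ τ j) ⟩
            sum (λ j → sum (λ τ → sum (λ i → Ĉ σ i * Ĉ τ i) * Ĉ τ j))
              ≡⟨ sum-cong-≗ (gram-⊛ Ĉ (Ĉ σ)) ⟩
            sum (gram Ĉ ⊛ Ĉ σ)
              ≡⟨ sum-gram (Ĉ σ) ⟩
            (κ + N̂) * sum (Ĉ σ)
              ≡⟨ cong (_* sum (Ĉ σ)) (sym ιμ≡) ⟩
            ι μ * sum (Ĉ σ) ∎
            where open ≡-Reasoning
          Cᵀv : sum (λ σ → Ĉ σ i₀ * sum (Ĉ σ)) ≡ κ + N̂
          Cᵀv = begin
            sum (λ σ → Ĉ σ i₀ * sum (Ĉ σ))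
              ≡⟨ sum-cong-≗ (λ σ → trans (*-comm (Ĉ σ i₀) (sum (Ĉ σ)))
                   (cong (_* Ĉ σ i₀) (sum-cong-≗ (λ i → sym (*-identityˡ (Ĉ σ i)))))) ⟩
            sum (λ σ → sum (λ i → ones i * Ĉ σ i) * Ĉ σ i₀)
              ≡⟨ gram-⊛ Ĉ ones i₀ ⟩
            (gram Ĉ ⊛ ones) i₀
              ≡⟨ gram-⊛≡ ones i₀ ⟩
            κ * 1ℚ + N̂
              ≡⟨ cong (_+ N̂) (*-identityʳ κ) ⟩
            κ + N̂ ∎
            where open ≡-Reasoning
          v≢0 : ¬ (∀ σ → v σ ≈ 0ᵣ)
          v≢0 v≈0 = <-irrefl refl (<-≤-trans (proj₂ small (proj₁ small) ℕ.≤-refl)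
            (≤-trans (≤-trans 1≤N̂ (≤-trans (≤-reflexive (sym (+-identityˡ N̂))) (+-monoˡ-≤ N̂ 0≤κ))) (p≤∣p∣ (κ + N̂))))
            where
            null : Null (λ _ → κ + N̂)
            null = null-cong {x = λ t → sum (λ σ → Ĉ σ i₀ * seq (v σ) t)} (λ _ → Cᵀv)
              (null-sum {x = λ σ t → Ĉ σ i₀ * seq (v σ) t}
                (λ σ → null-scale (Ĉ σ i₀) {seq (v σ)} (≈0⇒null (v σ) (v≈0 σ))))
            small = null 1ℚ 0<1

        -- Put `w = Cᵀ v`, with coordinate sum `c`. Applying `Cᵀ` to the eigenvalue equation makes
        -- `(κ - ν) w + c` tend to 0 in every coordinate, and summation makes `(κ + N̂ - ν) c` tend
        -- to 0. As `ν` exceeds `μ = κ + N̂` by `δ`, the factors `κ + N̂ - ν`, `κ - ν` and `- ν` all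
        -- stay `δ` away from 0. Hence `c` vanishes, then `w`, and then `v`, because `ν v` agrees
        -- with `C w`.
        module _ (ν : ℝ) (v : Fin r → ℝ) (eigen : ∀ σ → (real L ·ᵥ v) σ ≈ ν *ᵣ v σ)
          {δ} (0<δ : 0ℚ < δ) (M : ℕ) (far : ∀ t → M ℕ.≤ t → ι μ + δ ≤ seq ν t) where

          private
            w : Fin n → ℕ → ℚ
            w i t = sum (λ σ → Ĉ σ i * seq (v σ) t)

            c : ℕ → ℚ
            c t = sum (λ i → w i t)

            residue : Fin r → ℕ → ℚ
            residue σ t = (Ĉ ⊛ (λ i → w i t)) σ - seq ν t * seq (v σ) t

            L≡C⊛w : ∀ σ t → seq ((real L ·ᵥ v) σ) t ≡ (Ĉ ⊛ (λ i → w i t)) σ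
            L≡C⊛w σ t = begin
              seq ((real L ·ᵥ v) σ) t
                ≡⟨ seq-L v σ t ⟩
              sum (λ τ → sum (λ i → Ĉ σ i * Ĉ τ i) * seq (v τ) t)
                ≡⟨ sum-cong-≗ (λ τ → *-distribʳ-sum (seq (v τ) t) (λ i → Ĉ σ i * Ĉ τ i)) ⟩
              sum (λ τ → sum (λ i → Ĉ σ i * Ĉ τ i * seq (v τ) t))
                ≡⟨ ∑-comm (λ τ i → Ĉ σ i * Ĉ τ i * seq (v τ) t) ⟩
              sum (λ i → sum (λ τ → Ĉ σ i * Ĉ τ i * seq (v τ) t))
                ≡⟨ sum-cong-≗ (λ i → trans (sum-cong-≗ (λ τ → *-assoc (Ĉ σ i) (Ĉ τ i) (seq (v τ) t)))
                     (sym (*-distribˡ-sum (Ĉ σ i) (λ τ → Ĉ τ i * seq (v τ) t)))) ⟩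
              (Ĉ ⊛ (λ i → w i t)) σ ∎
              where open ≡-Reasoning

            residue-null : ∀ σ → Null (residue σ)
            residue-null σ = null-cong {x = λ t → seq ((real L ·ᵥ v) σ) t - seq ν t * seq (v σ) t}
              (λ t → cong (_- seq ν t * seq (v σ) t) (L≡C⊛w σ t)) (eigen σ)

            Cᵀresidue : ∀ i t → sum (λ σ → Ĉ σ i * residue σ t) ≡ (κ - seq ν t) * w i t + c t
            Cᵀresidue i t = begin
              sum (λ σ → Ĉ σ i * residue σ t)
                ≡⟨ sum-cong-≗ (λ σ → solve 4 (λ C x ν v → C :* (x :- ν :* v) := x :* C :+ :- ν :* (C :* v)) refl
                     (Ĉ σ i) ((Ĉ ⊛ ŵ) σ) (seq ν t) (seq (v σ) t)) ⟩
              sum (λ σ → (Ĉ ⊛ ŵ) σ * Ĉ σ i + - seq ν t * (Ĉ σ i * seq (v σ) t))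
                ≡⟨ ∑-distrib-+ (λ σ → (Ĉ ⊛ ŵ) σ * Ĉ σ i) (λ σ → - seq ν t * (Ĉ σ i * seq (v σ) t)) ⟩
              sum (λ σ → (Ĉ ⊛ ŵ) σ * Ĉ σ i) + sum (λ σ → - seq ν t * (Ĉ σ i * seq (v σ) t))
                ≡⟨ cong₂ _+_
                     (trans (sum-cong-≗ (λ σ → cong (_* Ĉ σ i) (sum-cong-≗ (λ j → *-comm (Ĉ σ j) (ŵ j)))))
                       (trans (gram-⊛ Ĉ ŵ i) (gram-⊛≡ ŵ i)))
                     (sym (*-distribˡ-sum (- seq ν t) (λ σ → Ĉ σ i * seq (v σ) t))) ⟩
              (κ * ŵ i + c t) + - seq ν t * ŵ i
                ≡⟨ solve 4 (λ κ w c ν → (κ :* w :+ c) :+ :- ν :* w := (κ :- ν) :* w :+ c) refl κ (ŵ i) (c t) (seq ν t) ⟩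
              (κ - seq ν t) * w i t + c t ∎
              where
              open ≡-Reasoning
              ŵ : Vector n
              ŵ j = w j t

            shifted-null : ∀ i → Null (λ t → (κ - seq ν t) * w i t + c t)
            shifted-null i = null-cong {x = λ t → sum (λ σ → Ĉ σ i * residue σ t)} (Cᵀresidue i)
              (null-sum {x = λ σ t → Ĉ σ i * residue σ t} (λ σ → null-scale (Ĉ σ i) {residue σ} (residue-null σ)))

            away : ∀ {a} → a ≤ ι μ → ∃[ M ] (∀ t → M ℕ.≤ t → δ ≤ ∣ a - seq ν t ∣)
            away {a} a≤μ = M , λ t M≤t → begin
              δ                  ≡⟨ solve 2 (λ δ a → δ := (a :+ δ) :- a) refl δ a ⟩
              (a + δ) - a        ≤⟨ +-monoˡ-≤ (- a) (≤-trans (+-monoˡ-≤ δ a≤μ) (far t M≤t)) ⟩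
              seq ν t - a        ≤⟨ p≤∣p∣ (seq ν t - a) ⟩
              ∣ seq ν t - a ∣    ≡⟨ cong ∣_∣ (solve 2 (λ ν a → ν :- a := :- (a :- ν)) refl (seq ν t) a) ⟩
              ∣ - (a - seq ν t) ∣ ≡⟨ ∣-p∣≡∣p∣ (a - seq ν t) ⟩
              ∣ a - seq ν t ∣    ∎
              where open ≤-Reasoning

            sum-shifted : ∀ t → sum (λ i → (κ - seq ν t) * w i t + c t) ≡ (κ + N̂ - seq ν t) * c t
            sum-shifted t = begin
              sum (λ i → (κ - seq ν t) * w i t + c t)
                ≡⟨ sum-cong-≗ (λ i → cong (_+_ ((κ - seq ν t) * w i t)) (sym (*-identityˡ (c t)))) ⟩
              sum (λ i → (κ - seq ν t) * w i t + ones i * c t)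
                ≡⟨ ∑-distrib-+ (λ i → (κ - seq ν t) * w i t) (λ i → ones i * c t) ⟩
              sum (λ i → (κ - seq ν t) * w i t) + sum (λ i → ones i * c t)
                ≡⟨ cong₂ _+_ (sym (*-distribˡ-sum (κ - seq ν t) (λ i → w i t))) (sym (*-distribʳ-sum (c t) ones)) ⟩
              (κ - seq ν t) * c t + N̂ * c t
                ≡⟨ solve 4 (λ κ ν c N → (κ :- ν) :* c :+ N :* c := (κ :+ N :- ν) :* c) refl κ (seq ν t) (c t) N̂ ⟩
              (κ + N̂ - seq ν t) * c t ∎
              where open ≡-Reasoning

            c-null : Null c
            c-null = null-cancel (λ t → κ + N̂ - seq ν t) c 0<δ (away (≤-reflexive (sym ιμ≡)))
              (null-cong {x = λ t → sum (λ i → (κ - seq ν t) * w i t + c t)} sum-shifted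
                (null-sum {x = λ i t → (κ - seq ν t) * w i t + c t} shifted-null))

            w-null : ∀ i → Null (w i)
            w-null i = null-cancel (λ t → κ - seq ν t) (w i) 0<δ
              (away (≤-trans (≤-trans (≤-reflexive (sym (+-identityʳ κ)))
                (+-monoʳ-≤ κ (≤-trans (<⇒≤ 0<1) 1≤N̂))) (≤-reflexive (sym ιμ≡))))
              (null-cong {x = λ t → (κ - seq ν t) * w i t + c t + - 1ℚ * c t}
                (λ t → solve 2 (λ a c → a :+ c :+ :- con 1ℚ :* c := a) refl ((κ - seq ν t) * w i t) (c t))
                (null-+ {λ t → (κ - seq ν t) * w i t + c t} {λ t → - 1ℚ * c t}
                  (shifted-null i) (null-scale (- 1ℚ) {c} c-null)))

          far⇒v≈0 : ∀ σ → v σ ≈ 0ᵣ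
          far⇒v≈0 σ = null⇒≈0 (v σ) (null-cancel (λ t → 0ℚ - seq ν t) (seq (v σ)) 0<δ
            (away (≤-trans (+-mono-≤ 0≤κ (≤-trans (<⇒≤ 0<1) 1≤N̂)) (≤-reflexive (sym ιμ≡))))
            (null-cong {x = λ t → residue σ t + - 1ℚ * (Ĉ ⊛ (λ i → w i t)) σ}
              (λ t → solve 3 (λ x ν v → x :- ν :* v :+ :- con 1ℚ :* x := (con 0ℚ :- ν) :* v) refl
                ((Ĉ ⊛ (λ i → w i t)) σ) (seq ν t) (seq (v σ) t))
              (null-+ {residue σ} {λ t → - 1ℚ * (Ĉ ⊛ (λ i → w i t)) σ} (residue-null σ)
                (null-scale (- 1ℚ) {λ t → (Ĉ ⊛ (λ i → w i t)) σ}
                  (null-sum {x = λ i t → Ĉ σ i * w i t} (λ i → null-scale (Ĉ σ i) {w i} (w-null i)))))))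

        isLargest : IsLargestEigenvalue (real L) (fromℤ μ)
        isLargest = isEigenvalue , λ ν (v , v≢0 , eigen) →
          ≤ᵣ-intro ν (ι μ) (λ 0<δ M far → v≢0 (far⇒v≈0 ν v eigen 0<δ M far))

-- Balanced signed graphs and their switching functions.

module Switching where

  open import Data.Empty using (⊥-elim)
  open import Data.Integer.Base using (ℤ; 1ℤ; _*_)
  open import Data.Integer.Properties
  open import Data.List.Base using (List; []; _∷_; [_]; _++_; length)
  open import Data.List.Membership.Propositional.Properties using (∈-∃++)
  open import Data.List.Properties using (++-assoc; length-++)
  open import Data.List.Relation.Unary.All.Properties using (¬Any⇒All¬)
  open import Data.List.Relation.Unary.AllPairs using ([]; _∷_)
  open import Data.List.Relation.Unary.Any using (any?)
  open import Data.List.Relation.Unary.Linked using (Linked; []; [-]; _∷_)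
  open import Data.List.Relation.Unary.Unique.Propositional using (Unique)
  open import Data.Nat.Base as ℕ using (ℕ; suc; _≤_; z≤n; s≤s)
  import Data.Nat.Properties as ℕ
  open import Data.Product.Base using (∃-syntax; _,_)
  open import Data.Sum.Base using (_⊎_; inj₁; inj₂)
  open import Level using (0ℓ)
  open import Relation.Binary.Construct.Closure.ReflexiveTransitive using (Star; ε; _◅_; _◅◅_)
  open import Relation.Binary.Core using (Rel)
  open import Relation.Binary.Definitions using (DecidableEquality)
  open import Relation.Binary.PropositionalEquality hiding ([_])
  open import Relation.Nullary.Decidable using (yes; no)

  module _ {V : Set} (_≟ᵥ_ : DecidableEquality V) where

    unique⊎repetition : (xs : List V) →
      Unique xs ⊎ ∃[ as ] ∃[ y ] ∃[ bs ] ∃[ cs ] (xs ≡ as ++ y ∷ bs ++ y ∷ cs)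
    unique⊎repetition []       = inj₁ []
    unique⊎repetition (x ∷ xs) with any? (x ≟ᵥ_) xs | unique⊎repetition xs
    ... | yes x∈xs | _ with ∈-∃++ x∈xs
    ...   | bs , cs , eq = inj₂ ([] , x , bs , cs , cong (x ∷_) eq)
    unique⊎repetition (x ∷ xs) | no x∉xs | inj₁ u = inj₁ (¬Any⇒All¬ xs x∉xs ∷ u)
    unique⊎repetition (x ∷ xs) | no x∉xs | inj₂ (as , y , bs , cs , eq) =
      inj₂ (x ∷ as , y , bs , cs , cong (x ∷_) eq)

  module _ {V : Set} {_~_ : Rel V 0ℓ} where

    linked-prefix : ∀ as {y zs} → Linked _~_ (as ++ y ∷ zs) → Linked _~_ (as ++ [ y ])
    linked-prefix []           l       = [-]
    linked-prefix (a ∷ [])     (e ∷ _) = e ∷ [-]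
    linked-prefix (a ∷ b ∷ as) (e ∷ l) = e ∷ linked-prefix (b ∷ as) l

    linked-suffix : ∀ as {y zs} → Linked _~_ (as ++ y ∷ zs) → Linked _~_ (y ∷ zs)
    linked-suffix []           l       = l
    linked-suffix (a ∷ [])     (_ ∷ l) = l
    linked-suffix (a ∷ b ∷ as) (_ ∷ l) = linked-suffix (b ∷ as) l

    linked-join : ∀ as {y zs} → Linked _~_ (as ++ [ y ]) → Linked _~_ (y ∷ zs) → Linked _~_ (as ++ y ∷ zs)
    linked-join []           _       m = m
    linked-join (a ∷ [])     (e ∷ _) m = e ∷ m
    linked-join (a ∷ b ∷ as) (e ∷ l) m = e ∷ linked-join (b ∷ as) l m

  module Balance {V : Set} (_≟ᵥ_ : DecidableEquality V) (_~_ : Rel V 0ℓ) (s : V → V → ℤ)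
    (~-irrefl : ∀ {x y} → x ~ y → x ≢ y) (~-sym : ∀ {x y} → x ~ y → y ~ x)
    (s-sym : ∀ x y → s x y ≡ s y x) (s² : ∀ {x y} → x ~ y → s x y * s x y ≡ 1ℤ)
    (balanced : Balanced _~_ s) where

    private
      sign : List V → ℤ
      sign = walkSign _~_ s

    sign-++ : ∀ as y zs → sign (as ++ y ∷ zs) ≡ sign (as ++ [ y ]) * sign (y ∷ zs)
    sign-++ []           y zs = sym (*-identityˡ (sign (y ∷ zs)))
    sign-++ (a ∷ [])     y zs = cong (_* sign (y ∷ zs)) (sym (*-identityʳ (s a y)))
    sign-++ (a ∷ b ∷ as) y zs = trans (cong (s a b *_) (sign-++ (b ∷ as) y zs))
      (sym (*-assoc (s a b) (sign (b ∷ as ++ [ y ])) (sign (y ∷ zs))))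

    -- `Balanced` speaks of cycles with at least three vertices. A closed walk on one vertex would
    -- be a loop, and one on two vertices runs twice over a single edge and has a square as its
    -- sign.
    cycle-sign : ∀ x xs → Unique (x ∷ xs) → Linked _~_ (x ∷ xs ++ [ x ]) → sign (x ∷ xs ++ [ x ]) ≡ 1ℤ
    cycle-sign x []           _ (e ∷ _) = ⊥-elim (~-irrefl e refl)
    cycle-sign x (y ∷ [])     _ (e ∷ _) = trans
      (cong (s x y *_) (trans (*-identityʳ (s y x)) (s-sym y x))) (s² e)
    cycle-sign x (y ∷ z ∷ xs) u l       = balanced x (y ∷ z ∷ xs) (s≤s (s≤s z≤n)) u l

    -- A closed walk that repeats a vertex splits there into two shorter closed walks.
    closed-sign : ∀ m x xs → length xs ℕ.< m → Linked _~_ (x ∷ xs ++ [ x ]) → sign (x ∷ xs ++ [ x ]) ≡ 1ℤ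
    closed-sign (suc m) x xs len l with unique⊎repetition _≟ᵥ_ (x ∷ xs)
    ... | inj₁ u = cycle-sign x xs u l
    closed-sign (suc m) x xs len l | inj₂ ([] , .x , bs , cs , refl)
      rewrite ++-assoc bs (x ∷ cs) [ x ] = begin
        sign (x ∷ bs ++ x ∷ cs ++ [ x ])
          ≡⟨ sign-++ (x ∷ bs) x (cs ++ [ x ]) ⟩
        sign (x ∷ bs ++ [ x ]) * sign (x ∷ cs ++ [ x ])
          ≡⟨ cong₂ _*_ (closed-sign m x bs len-bs (linked-prefix (x ∷ bs) l))
               (closed-sign m x cs len-cs (linked-suffix (x ∷ bs) l)) ⟩
        1ℤ ∎
      where
      open ≡-Reasoning
      total : suc (length bs ℕ.+ length cs) ≤ m
      total = ℕ.≤-pred (subst (ℕ._< suc m) (trans (length-++ bs) (ℕ.+-suc (length bs) (length cs))) len)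
      len-bs = ℕ.≤-trans (s≤s (ℕ.m≤m+n (length bs) (length cs))) total
      len-cs = ℕ.≤-trans (s≤s (ℕ.m≤n+m (length cs) (length bs))) total
    -- The repeated vertex `y` lies past the base: the loop at `y` is cut out with sign 1, and what
    -- is left is a shorter closed walk at `x`.
    closed-sign (suc m) x xs len l | inj₂ (.x ∷ as , y , bs , cs , refl)
      rewrite ++-assoc as (y ∷ bs ++ y ∷ cs) [ x ] | ++-assoc bs (y ∷ cs) [ x ] = begin
        sign (x ∷ as ++ y ∷ bs ++ y ∷ cs ++ [ x ])
          ≡⟨ sign-++ (x ∷ as) y (bs ++ y ∷ cs ++ [ x ]) ⟩
        sign (x ∷ as ++ [ y ]) * sign (y ∷ bs ++ y ∷ cs ++ [ x ])
          ≡⟨ cong (sign (x ∷ as ++ [ y ]) *_) (sign-++ (y ∷ bs) y (cs ++ [ x ])) ⟩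
        sign (x ∷ as ++ [ y ]) * (sign (y ∷ bs ++ [ y ]) * sign (y ∷ cs ++ [ x ]))
          ≡⟨ cong (λ e → sign (x ∷ as ++ [ y ]) * (e * sign (y ∷ cs ++ [ x ])))
               (closed-sign m y bs len-bs (linked-prefix (y ∷ bs) l-inner)) ⟩
        sign (x ∷ as ++ [ y ]) * (1ℤ * sign (y ∷ cs ++ [ x ]))
          ≡⟨ cong (sign (x ∷ as ++ [ y ]) *_) (*-identityˡ _) ⟩
        sign (x ∷ as ++ [ y ]) * sign (y ∷ cs ++ [ x ])
          ≡⟨ sym (sign-++ (x ∷ as) y (cs ++ [ x ])) ⟩
        sign (x ∷ as ++ y ∷ cs ++ [ x ])
          ≡⟨ cong (λ zs → sign (x ∷ zs)) (sym (++-assoc as (y ∷ cs) [ x ])) ⟩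
        sign (x ∷ (as ++ y ∷ cs) ++ [ x ])
          ≡⟨ closed-sign m x (as ++ y ∷ cs) len-outer
               (subst (λ zs → Linked _~_ (x ∷ zs)) (sym (++-assoc as (y ∷ cs) [ x ]))
                 (linked-join (x ∷ as) (linked-prefix (x ∷ as) l) (linked-suffix (y ∷ bs) l-inner))) ⟩
        1ℤ ∎
      where
      open ≡-Reasoning
      l-inner = linked-suffix (x ∷ as) l
      a = length as
      b = length bs
      c = length cs
      total : suc (a ℕ.+ (b ℕ.+ suc c)) ≤ m
      total = ℕ.≤-pred (subst (ℕ._< suc m) (trans (length-++ as)
        (trans (cong (λ e → a ℕ.+ suc e) (length-++ bs)) (ℕ.+-suc a (b ℕ.+ suc c)))) len)
      len-bs : b ℕ.< m
      len-bs = ℕ.≤-trans (s≤s (ℕ.≤-trans (ℕ.m≤m+n b (suc c)) (ℕ.m≤n+m (b ℕ.+ suc c) a))) total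
      len-outer : length (as ++ y ∷ cs) ℕ.< m
      len-outer = ℕ.≤-trans (s≤s (ℕ.≤-trans (ℕ.≤-reflexive (length-++ as))
        (ℕ.+-monoʳ-≤ a (ℕ.m≤n+m (suc c) b)))) total

    starSign : ∀ {x y} → Star _~_ x y → ℤ
    starSign ε                       = 1ℤ
    starSign (_◅_ {i = x} {j = y} _ p) = s x y * starSign p

    starSign-◅◅ : ∀ {x y z} (p : Star _~_ x y) (q : Star _~_ y z) →
      starSign (p ◅◅ q) ≡ starSign p * starSign q
    starSign-◅◅ ε       q = sym (*-identityˡ (starSign q))
    starSign-◅◅ (_◅_ {i = x} {j = y} e p) q = trans (cong (s x y *_) (starSign-◅◅ p q))
      (sym (*-assoc (s x y) (starSign p) (starSign q)))

    backwards : ∀ {x y} → Star _~_ x y → Star _~_ y x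
    backwards ε       = ε
    backwards (e ◅ p) = backwards p ◅◅ (~-sym e ◅ ε)

    starSign-backwards : ∀ {x y} (p : Star _~_ x y) → starSign (backwards p) ≡ starSign p
    starSign-backwards ε = refl
    starSign-backwards (_◅_ {i = x} {j = y} e p) = begin
      starSign (backwards p ◅◅ (~-sym e ◅ ε))   ≡⟨ starSign-◅◅ (backwards p) (~-sym e ◅ ε) ⟩
      starSign (backwards p) * (s y x * 1ℤ)     ≡⟨ cong₂ _*_ (starSign-backwards p)
                                                     (trans (*-identityʳ (s y x)) (s-sym y x)) ⟩
      starSign p * s x y                        ≡⟨ *-comm (starSign p) (s x y) ⟩
      s x y * starSign p                        ∎
      where open ≡-Reasoning

    private
      initial : ∀ {x y} → Star _~_ x y → List V
      initial ε                   = []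
      initial (_◅_ {i = x} e p) = x ∷ initial p

      linked-initial : ∀ {x y} (p : Star _~_ x y) → Linked _~_ (initial p ++ [ y ])
      linked-initial ε           = [-]
      linked-initial (e ◅ ε)     = e ∷ [-]
      linked-initial (e ◅ f ◅ p) = e ∷ linked-initial (f ◅ p)

      sign-initial : ∀ {x y} (p : Star _~_ x y) → sign (initial p ++ [ y ]) ≡ starSign p
      sign-initial ε           = refl
      sign-initial (e ◅ ε)     = refl
      sign-initial (_◅_ {i = x} {j = y} e (f ◅ p)) = cong (s x y *_) (sign-initial (f ◅ p))

    starSign-closed : ∀ {x} (p : Star _~_ x x) → starSign p ≡ 1ℤ
    starSign-closed ε       = refl
    starSign-closed {x} (e ◅ p) = trans (sym (sign-initial (e ◅ p)))
      (closed-sign (suc (length (initial p))) x (initial p) ℕ.≤-refl (linked-initial (e ◅ p)))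

    -- A walk followed by its reverse is closed, and the reverse has the same sign.
    starSign² : ∀ {x y} (p : Star _~_ x y) → starSign p * starSign p ≡ 1ℤ
    starSign² p = trans (cong (starSign p *_) (sym (starSign-backwards p)))
      (trans (sym (starSign-◅◅ p (backwards p))) (starSign-closed (p ◅◅ backwards p)))

    -- One half of Harary's balance theorem: signs of walks from a base form a potential that
    -- switches every edge to +1, since going out along `p`, over the edge and back along `q` is a
    -- closed walk.
    starSign-switch : ∀ {b x y} (p : Star _~_ b x) (q : Star _~_ b y) → x ~ y →
      starSign p * (s x y * starSign q) ≡ 1ℤ
    starSign-switch {x = x} {y} p q e = trans
      (cong (λ t → starSign p * (s x y * t)) (sym (starSign-backwards q)))
      (trans (sym (starSign-◅◅ p (e ◅ backwards q))) (starSign-closed (p ◅◅ (e ◅ backwards q))))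

-- Enumerating and counting subsets.

module SubsetLists where

  open import Data.Fin.Base using (zero; suc)
  open import Data.Fin.Subset using (Subset; inside; outside; _∈_; _⊆_; _∩_; ∣_∣; _-_)
  open import Data.Fin.Subset.Properties
    using (_∈?_; _⊆?_; ⊆-refl; ⊆-antisym; out⊆; in⊆in; drop-∷-⊆; p∩q⊆p; p∩q⊆q; x∈p∩q⁺;
           p⊂q⇒∣p∣<∣q∣; p─⊥≡p)
  import Data.Bool.Properties as Bool
  open import Data.List.Base using (List; []; _∷_; _++_; length; lookup; map; filter)
  open import Data.List.Membership.Propositional as List using ()
  open import Data.List.Membership.Propositional.Properties
    using (∈-map⁺; ∈-map⁻; ∈-++⁺ˡ; ∈-++⁺ʳ; ∈-lookup)
  open import Data.List.Properties using (length-++; filter-++)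
  open import Data.List.Relation.Unary.All as All using ([]; _∷_)
  open import Data.List.Relation.Unary.AllPairs using ([]; _∷_)
  open import Data.List.Relation.Unary.Any using (here; there)
  open import Data.List.Relation.Unary.Unique.Propositional using (Unique)
  open import Data.List.Relation.Unary.Unique.Propositional.Properties using (map⁺; ++⁺)
  open import Data.Nat.Base as ℕ using (ℕ; zero; suc; _≤_; _+_)
  import Data.Nat.Properties as ℕ
  open import Data.Product.Base using (∃-syntax; _×_; _,_)
  open import Data.Vec.Base using ([]; _∷_)
  import Data.Vec.Base as Vec
  import Data.Vec.Properties as Vec
  open import Function.Bundles using (_⇔_; mk⇔; Equivalence)
  open import Relation.Binary.PropositionalEquality hiding ([_])
  open import Relation.Nullary.Decidable using (Dec; yes; no; _×-dec_; decidable-stable)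
  open import Relation.Nullary.Negation using (¬_; contradiction)
  open import Relation.Unary using (Decidable)

  ⊆∧∣∣≥⇒≡ : ∀ {n} {p q : Subset n} → p ⊆ q → ∣ q ∣ ≤ ∣ p ∣ → p ≡ q
  ⊆∧∣∣≥⇒≡ {p = p} p⊆q ∣q∣≤∣p∣ = ⊆-antisym p⊆q λ {x} x∈q →
    decidable-stable (x ∈? p) λ x∉p → ℕ.<⇒≱ (p⊂q⇒∣p∣<∣q∣ (p⊆q , x , x∈q , x∉p)) ∣q∣≤∣p∣

  ⊆-cover : ∀ {n} (p q : Subset n) → p ⊆ q → ∣ q ∣ ≡ suc ∣ p ∣ → ∃[ v ] (v ∈ q × p ≡ q - v)
  ⊆-cover (outside ∷ p) (outside ∷ q) p⊆q eq with ⊆-cover p q (drop-∷-⊆ p⊆q) eq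
  ... | v , v∈q , p≡q-v = suc v , Vec.there v∈q , cong (outside ∷_) p≡q-v
  ⊆-cover (inside ∷ p) (inside ∷ q) p⊆q eq with ⊆-cover p q (drop-∷-⊆ p⊆q) (ℕ.suc-injective eq)
  ... | v , v∈q , p≡q-v = suc v , Vec.there v∈q , cong (inside ∷_) p≡q-v
  ⊆-cover (outside ∷ p) (inside ∷ q) p⊆q eq = zero , Vec.here , cong (outside ∷_)
    (trans (⊆∧∣∣≥⇒≡ (drop-∷-⊆ p⊆q) (ℕ.≤-reflexive (ℕ.suc-injective eq))) (sym (p─⊥≡p q)))
  ⊆-cover (inside ∷ p) (outside ∷ q) p⊆q eq with () ← p⊆q Vec.here

  -- Being proper in `p`, the intersection has at most as many elements as `r`, which it contains.
  -- So two distinct facets share at most one ridge.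
  common-subset≡∩ : ∀ {n} {p q r : Subset n} → ∣ p ∣ ≡ ∣ q ∣ → p ≢ q → r ⊆ p → r ⊆ q →
    ∣ p ∣ ≡ suc ∣ r ∣ → r ≡ p ∩ q
  common-subset≡∩ {p = p} {q} {r} ∣p∣≡∣q∣ p≢q r⊆p r⊆q ∣p∣≡ =
    ⊆∧∣∣≥⇒≡ (λ x∈r → x∈p∩q⁺ (r⊆p x∈r , r⊆q x∈r)) (ℕ.≤-pred (subst (∣ p ∩ q ∣ ℕ.<_) ∣p∣≡ (ℕ.≰⇒> λ ∣p∣≤ →
      p≢q (⊆∧∣∣≥⇒≡ (λ x∈p → p∩q⊆q p q (subst (_ ∈_) (sym (⊆∧∣∣≥⇒≡ (p∩q⊆p p q) ∣p∣≤)) x∈p))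
        (ℕ.≤-reflexive (sym ∣p∣≡∣q∣))))))

  ∈-allSubsets : ∀ {n} (p : Subset n) → p List.∈ allSubsets n
  ∈-allSubsets []            = here refl
  ∈-allSubsets (outside ∷ p) = ∈-++⁺ˡ (∈-map⁺ (outside ∷_) (∈-allSubsets p))
  ∈-allSubsets (inside  ∷ p) = ∈-++⁺ʳ (map (outside ∷_) (allSubsets _)) (∈-map⁺ (inside ∷_) (∈-allSubsets p))

  allSubsets-unique : ∀ n → Unique (allSubsets n)
  allSubsets-unique zero    = [] ∷ []
  allSubsets-unique (suc n) = ++⁺ (map⁺ Vec.∷-injectiveʳ (allSubsets-unique n))
    (map⁺ Vec.∷-injectiveʳ (allSubsets-unique n)) disjoint
    where
    disjoint : ∀ {p} → ¬ (p List.∈ map (outside ∷_) (allSubsets n) × p List.∈ map (inside ∷_) (allSubsets n))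
    disjoint (p∈out , p∈in) with ∈-map⁻ (outside ∷_) p∈out | ∈-map⁻ (inside ∷_) p∈in
    ... | _ , _ , refl | _ , _ , ()

  lookup-injective : ∀ {A : Set} {xs : List A} → Unique xs → ∀ {i j} → lookup xs i ≡ lookup xs j → i ≡ j
  lookup-injective (x∉ ∷ u) {zero}  {zero}  eq = refl
  lookup-injective (x∉ ∷ u) {zero}  {suc j} eq = contradiction eq (All.lookup x∉ (∈-lookup j))
  lookup-injective (x∉ ∷ u) {suc i} {zero}  eq = contradiction (sym eq) (All.lookup x∉ (∈-lookup i))
  lookup-injective (x∉ ∷ u) {suc i} {suc j} eq = cong suc (lookup-injective u eq)

  module _ {A : Set} {P Q : A → Set} (P? : Decidable P) (Q? : Decidable Q) where

    length-filter-cong : (∀ x → P x ⇔ Q x) → ∀ xs → length (filter P? xs) ≡ length (filter Q? xs)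
    length-filter-cong P⇔Q []       = refl
    length-filter-cong P⇔Q (x ∷ xs) with P? x | Q? x
    ... | yes _ | yes _ = cong suc (length-filter-cong P⇔Q xs)
    ... | no  _ | no  _ = length-filter-cong P⇔Q xs
    ... | yes p | no ¬q = contradiction (Equivalence.to (P⇔Q x) p) ¬q
    ... | no ¬p | yes q = contradiction (Equivalence.from (P⇔Q x) q) ¬p

    filter-filter : ∀ xs → filter P? (filter Q? xs) ≡ filter (λ x → P? x ×-dec Q? x) xs
    filter-filter []       = refl
    filter-filter (x ∷ xs) with Q? x
    filter-filter (x ∷ xs) | yes _ with P? x
    ... | yes _ = cong (x ∷_) (filter-filter xs)
    ... | no  _ = filter-filter xs
    filter-filter (x ∷ xs) | no _ with P? x
    ... | yes _ = filter-filter xs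
    ... | no  _ = filter-filter xs

  length-filter-map : ∀ {A B : Set} {P : B → Set} (P? : Decidable P) (f : A → B) xs →
    length (filter P? (map f xs)) ≡ length (filter (λ x → P? (f x)) xs)
  length-filter-map P? f []       = refl
  length-filter-map P? f (x ∷ xs) with P? (f x)
  ... | yes _ = cong suc (length-filter-map P? f xs)
  ... | no  _ = length-filter-map P? f xs

  length-filter-∅ : ∀ {A : Set} {P : A → Set} (P? : Decidable P) → (∀ x → ¬ P x) →
    ∀ xs → length (filter P? xs) ≡ 0
  length-filter-∅ P? ¬P []       = refl
  length-filter-∅ P? ¬P (x ∷ xs) with P? x
  ... | yes p = contradiction p (¬P x)
  ... | no  _ = length-filter-∅ P? ¬P xs

  count-split : ∀ {n} {P : Subset (suc n) → Set} (P? : Decidable P) →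
    length (filter P? (allSubsets (suc n)))
      ≡ length (filter (λ p → P? (outside ∷ p)) (allSubsets n))
        + length (filter (λ p → P? (inside ∷ p)) (allSubsets n))
  count-split {n} P? = begin
    length (filter P? (map (outside ∷_) S ++ map (inside ∷_) S))
      ≡⟨ cong length (filter-++ P? (map (outside ∷_) S) (map (inside ∷_) S)) ⟩
    length (filter P? (map (outside ∷_) S) ++ filter P? (map (inside ∷_) S))
      ≡⟨ length-++ (filter P? (map (outside ∷_) S)) ⟩
    length (filter P? (map (outside ∷_) S)) + length (filter P? (map (inside ∷_) S))
      ≡⟨ cong₂ _+_ (length-filter-map P? (outside ∷_) S) (length-filter-map P? (inside ∷_) S) ⟩
    length (filter (λ p → P? (outside ∷ p)) S) + length (filter (λ p → P? (inside ∷ p)) S) ∎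
    where
    open ≡-Reasoning
    S = allSubsets n

  _≟ₛ_ : ∀ {n} (p q : Subset n) → Dec (p ≡ q)
  _≟ₛ_ = Vec.≡-dec Bool._≟_

  count-≡ : ∀ {n} (q : Subset n) → length (filter (_≟ₛ q) (allSubsets n)) ≡ 1
  count-≡ []            = refl
  count-≡ {suc n} (outside ∷ q) = trans (count-split (_≟ₛ (outside ∷ q))) (cong₂ _+_
    (trans (length-filter-cong (λ p → (outside ∷ p) ≟ₛ (outside ∷ q)) (_≟ₛ q)
      (λ p → mk⇔ Vec.∷-injectiveʳ (cong (outside ∷_))) (allSubsets n)) (count-≡ q))
    (length-filter-∅ (λ p → (inside ∷ p) ≟ₛ (outside ∷ q)) (λ _ ()) (allSubsets n)))
  count-≡ {suc n} (inside ∷ q) = trans (count-split (_≟ₛ (inside ∷ q))) (cong₂ _+_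
    (length-filter-∅ (λ p → (outside ∷ p) ≟ₛ (inside ∷ q)) (λ _ ()) (allSubsets n))
    (trans (length-filter-cong (λ p → (inside ∷ p) ≟ₛ (inside ∷ q)) (_≟ₛ q)
      (λ p → mk⇔ Vec.∷-injectiveʳ (cong (inside ∷_))) (allSubsets n)) (count-≡ q)))

  CoveredBy : ∀ {n} → Subset n → Subset n → Set
  CoveredBy q p = p ⊆ q × ∣ q ∣ ≡ suc ∣ p ∣

  coveredBy? : ∀ {n} (q : Subset n) → Decidable (CoveredBy q)
  coveredBy? q p = (p ⊆? q) ×-dec (∣ q ∣ ℕ.≟ suc ∣ p ∣)

  count-covered : ∀ {n} (q : Subset n) → length (filter (coveredBy? q) (allSubsets n)) ≡ ∣ q ∣
  count-covered []            = refl
  count-covered {suc n} (outside ∷ q) = trans (count-split (coveredBy? (outside ∷ q)))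
    (trans (cong₂ _+_
      (trans (length-filter-cong (λ p → coveredBy? (outside ∷ q) (outside ∷ p)) (coveredBy? q)
        (λ p → mk⇔ (λ (p⊆q , eq) → drop-∷-⊆ p⊆q , eq) (λ (p⊆q , eq) → out⊆ p⊆q , eq))
        (allSubsets n)) (count-covered q))
      (length-filter-∅ (λ p → coveredBy? (outside ∷ q) (inside ∷ p))
        (λ p (p⊆q , _) → inside⊈outside p⊆q) (allSubsets n)))
    (ℕ.+-identityʳ ∣ q ∣))
    where
    inside⊈outside : ∀ {p} → ¬ ((inside ∷ p) ⊆ (outside ∷ q))
    inside⊈outside p⊆q with () ← p⊆q Vec.here
  -- Omitting the head forces the tail to be all of `q`, a single subset; keeping it leaves one
  -- vertex of `q` to omit.
  count-covered {suc n} (inside ∷ q) = trans (count-split (coveredBy? (inside ∷ q))) (cong₂ _+_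
    (trans (length-filter-cong (λ p → coveredBy? (inside ∷ q) (outside ∷ p)) (_≟ₛ q)
      (λ p → mk⇔
        (λ (p⊆q , eq) → ⊆∧∣∣≥⇒≡ (drop-∷-⊆ p⊆q) (ℕ.≤-reflexive (ℕ.suc-injective eq)))
        (λ { refl → out⊆ ⊆-refl , refl }))
      (allSubsets n)) (count-≡ q))
    (trans (length-filter-cong (λ p → coveredBy? (inside ∷ q) (inside ∷ p)) (coveredBy? q)
      (λ p → mk⇔
        (λ (p⊆q , eq) → drop-∷-⊆ p⊆q , ℕ.suc-injective eq)
        (λ (p⊆q , eq) → in⊆in p⊆q , cong suc eq))
      (allSubsets n)) (count-covered q)))

-- Incidence numbers and the Gram matrix of the facets.

module Incidence where

  open RationalSums
  open PositiveOperators using (Vector)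
  open PerronFrobenius using (gram; _⊛_)
  open Spectrum
  open SubsetLists
  import Algebra.Properties.Monoid.Sum as MonoidSum
  import Data.Bool.Properties as Bool
  open import Data.Fin.Base using (Fin; zero; suc; toℕ)
  import Data.Fin.Properties as Fin
  open import Data.Fin.Subset using (Subset; _∈_; _⊆_; _∩_; ∣_∣; _-_)
  open import Data.Fin.Subset.Properties using (_⊆?_; p─q⊆p)
  open import Data.Integer.Base as ℤ using (ℤ; +_; 0ℤ; 1ℤ; -1ℤ)
  import Data.Integer.Properties as ℤ
  import Data.Integer.Solver as ℤ
  open import Data.List.Base using ([]; _∷_; length; lookup; filter; map; removeAt)
  open import Data.List.Membership.Propositional.Properties using (∈-filter⁺; ∈-filter⁻; ∈-lookup)
  open import Data.List.Relation.Unary.Any as Any using (Any)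
  open import Data.List.Relation.Unary.Any.Properties using (lookup-index)
  open import Data.List.Relation.Unary.Unique.Propositional.Properties using (filter⁺)
  open import Data.Nat.Base as ℕ using (ℕ; zero; suc)
  import Data.Nat.Properties as ℕ
  open import Data.Product.Base using (∃-syntax; _,_; proj₁; proj₂)
  open import Data.Rational.Base using (ℚ; 0ℚ; 1ℚ; _+_; _*_)
  open import Data.Rational.Properties
  open import Data.Rational.Solver using (module +-*-Solver)
  import Data.Vec.Properties as Vec
  open import Function.Bundles using (mk⇔; Equivalence)
  open import Relation.Binary.PropositionalEquality
  open import Relation.Nullary.Decidable using (Dec; yes; no; _×-dec_)
  open import Relation.Nullary.Negation using (¬_; contradiction)
  open import Relation.Unary using (Decidable)

  𝟙 : ∀ {P : Set} → Dec P → ℚ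
  𝟙 (yes _) = 1ℚ
  𝟙 (no _)  = 0ℚ

  sum-𝟙 : ∀ {A : Set} {P : A → Set} (P? : Decidable P) xs →
    sum (λ i → 𝟙 (P? (lookup xs i))) ≡ fromℕ (length (filter P? xs))
  sum-𝟙 P? []       = refl
  sum-𝟙 P? (x ∷ xs) with P? x
  ... | yes _ = trans (cong (_+_ 1ℚ) (sum-𝟙 P? xs)) (sym (fromℕ-suc (length (filter P? xs))))
  ... | no  _ = trans (+-identityˡ (sum (λ i → 𝟙 (P? (lookup xs i))))) (sum-𝟙 P? xs)

  sum-single : ∀ {n} {f : Vector n} i → (∀ j → j ≢ i → f j ≡ 0ℚ) → sum f ≡ f i
  sum-single {suc n} {f} zero    h = trans
    (cong (_+_ (f zero)) (sum-0 (λ j → h (suc j) λ ()))) (+-identityʳ (f zero))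
  sum-single {suc n} {f} (suc i) h = trans
    (cong (_+ sum (λ j → f (suc j))) (h zero λ ()))
    (trans (+-identityˡ (sum (λ j → f (suc j))))
      (sum-single i (λ j j≢i → h (suc j) (λ eq → j≢i (Fin.suc-injective eq)))))

  signs² : ∀ a b → (-1ℤ ℤ.^ a ℤ.* -1ℤ ℤ.^ b) ℤ.* (-1ℤ ℤ.^ a ℤ.* -1ℤ ℤ.^ b) ≡ 1ℤ
  signs² a b = trans
    (solve 2 (λ x y → (x :* y) :* (x :* y) := (x :* x) :* (y :* y)) refl (-1ℤ ℤ.^ a) (-1ℤ ℤ.^ b))
    (cong₂ ℤ._*_ (sign² a) (sign² b))
    where
    open ℤ.+-*-Solver
    sign² : ∀ a → -1ℤ ℤ.^ a ℤ.* -1ℤ ℤ.^ a ≡ 1ℤ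
    sign² zero    = refl
    sign² (suc a) = trans
      (solve 1 (λ x → (con -1ℤ :* x) :* (con -1ℤ :* x) := x :* x) refl (-1ℤ ℤ.^ a)) (sign² a)

  module _ {n : ℕ} (K : SimplicialComplex n) where

    face-at : ∀ j i → IsFace K j (lookup (faces K j) i)
    face-at j i = proj₂ (∈-filter⁻ (isFace? K j) {xs = allSubsets n} (∈-lookup i))

    index-of : ∀ {j p} → IsFace K j p → ∃[ i ] (lookup (faces K j) i ≡ p)
    index-of {j} {p} p-face = Any.index p∈ , sym (lookup-index p∈)
      where p∈ = ∈-filter⁺ (isFace? K j) (∈-allSubsets p) p-face

    faces-injective : ∀ j {i i′} → lookup (faces K j) i ≡ lookup (faces K j) i′ → i ≡ i′
    faces-injective j = lookup-injective (filter⁺ (isFace? K j) (allSubsets-unique n))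

    -- Downward closure makes every subset of `p` with one vertex removed a ridge, so there is one
    -- for each vertex of `p`.
    count-ridges : ∀ j {p} → IsFace K (suc j) p → length (filter (_⊆? p) (faces K j)) ≡ suc (suc j)
    count-ridges j {p} (p∈K , ∣p∣≡) = begin
      length (filter (_⊆? p) (filter (isFace? K j) (allSubsets n)))
        ≡⟨ cong length (filter-filter (_⊆? p) (isFace? K j) (allSubsets n)) ⟩
      length (filter (λ q → (q ⊆? p) ×-dec isFace? K j q) (allSubsets n))
        ≡⟨ length-filter-cong (λ q → (q ⊆? p) ×-dec isFace? K j q) (coveredBy? p) (λ q → mk⇔
             (λ (q⊆p , _ , ∣q∣≡) → q⊆p , trans ∣p∣≡ (cong suc (sym ∣q∣≡)))
             (λ (q⊆p , eq) → q⊆p , downClosed K q⊆p p∈K , ℕ.suc-injective (trans (sym eq) ∣p∣≡)))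
             (allSubsets n) ⟩
      length (filter (coveredBy? p) (allSubsets n))
        ≡⟨ trans (count-covered p) ∣p∣≡ ⟩
      suc (suc j) ∎
      where open ≡-Reasoning

  module _ {n : ℕ} {K : SimplicialComplex n} (o : Orientation K) where

    incidence-⊈ : ∀ σ F → ¬ σ ⊆ F → incidence o σ F ≡ 0ℤ
    incidence-⊈ σ F σ⊈F with Fin.any? (λ i → Vec.≡-dec Bool._≟_ σ (F - lookup (order o F) i))
    ... | yes (i , σ≡F-v) = contradiction
      (λ {x} x∈σ → p─q⊆p F _ (subst (x ∈_) σ≡F-v x∈σ)) σ⊈F
    ... | no _ = refl

    incidence² : ∀ {σ F} → Face K F → σ ⊆ F → ∣ F ∣ ≡ suc ∣ σ ∣ → incidence o σ F ℤ.* incidence o σ F ≡ 1ℤ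
    incidence² {σ} {F} F∈K σ⊆F ∣F∣≡ with Fin.any? (λ i → Vec.≡-dec Bool._≟_ σ (F - lookup (order o F) i))
    ... | yes (i , _) = signs² (toℕ i)
      (inversions (map (λ v → position v (order o σ)) (removeAt (order o F) i)))
    ... | no ∄i with ⊆-cover σ F σ⊆F ∣F∣≡
    ...   | v , v∈F , σ≡F-v = contradiction
      (Any.index v∈order , trans σ≡F-v (cong (F -_) (lookup-index v∈order))) ∄i
      where v∈order = Equivalence.from (order-verts o F∈K v) v∈F

    module _ (m : ℕ) where

      ridge : Fin (#faces K m) → Subset n
      ridge = lookup (faces K m)

      facet : Fin (#faces K (suc m)) → Subset n
      facet = lookup (faces K (suc m))

      private
        b : Fin (#faces K m) → Fin (#faces K (suc m)) → ℚ
        b σ i = ι (boundary o m σ i)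

        ∣facet∣≡ : ∀ i σ → ∣ facet i ∣ ≡ suc ∣ ridge σ ∣
        ∣facet∣≡ i σ = trans (proj₂ (face-at K (suc m) i)) (cong suc (sym (proj₂ (face-at K m σ))))

        b-⊈ : ∀ σ i → ¬ ridge σ ⊆ facet i → b σ i ≡ 0ℚ
        b-⊈ σ i σ⊈ = cong ι (incidence-⊈ (ridge σ) (facet i) σ⊈)

        b² : ∀ σ i → b σ i * b σ i ≡ 𝟙 (ridge σ ⊆? facet i)
        b² σ i with ridge σ ⊆? facet i
        ... | yes σ⊆ = trans (sym (ι-* (boundary o m σ i) (boundary o m σ i)))
          (cong ι (incidence² (proj₁ (face-at K (suc m) i)) σ⊆ (∣facet∣≡ i σ)))
        ... | no σ⊈  = trans (cong (_* b σ i) (b-⊈ σ i σ⊈)) (*-zeroˡ (b σ i))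

        ridge≡∩ : ∀ {i j} → i ≢ j → ∀ σ → ridge σ ⊆ facet i → ridge σ ⊆ facet j → ridge σ ≡ facet i ∩ facet j
        ridge≡∩ {i} {j} i≢j σ σ⊆i σ⊆j = common-subset≡∩
          (trans (∣facet∣≡ i σ) (sym (∣facet∣≡ j σ))) (λ eq → i≢j (faces-injective K (suc m) eq)) σ⊆i σ⊆j (∣facet∣≡ i σ)

        -- A ridge in both facets is their intersection, so an off-diagonal Gram entry has at most
        -- one nonzero term.
        b*b-≢∩ : ∀ {i j} → i ≢ j → ∀ σ → ridge σ ≢ facet i ∩ facet j → b σ i * b σ j ≡ 0ℚ
        b*b-≢∩ {i} {j} i≢j σ σ≢ with ridge σ ⊆? facet i | ridge σ ⊆? facet j
        ... | no σ⊈i | _      = trans (cong (_* b σ j) (b-⊈ σ i σ⊈i)) (*-zeroˡ (b σ j))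
        ... | yes _  | no σ⊈j = trans (cong (b σ i *_) (b-⊈ σ j σ⊈j)) (*-zeroʳ (b σ i))
        ... | yes σ⊆i | yes σ⊆j = contradiction (ridge≡∩ i≢j σ σ⊆i σ⊆j) σ≢

      gram-diagonal : ∀ i → gram b i i ≡ fromℕ (suc (suc m))
      gram-diagonal i = begin
        sum (λ σ → b σ i * b σ i)                        ≡⟨ sum-cong-≗ (λ σ → b² σ i) ⟩
        sum (λ σ → 𝟙 (ridge σ ⊆? facet i))               ≡⟨ sum-𝟙 (_⊆? facet i) (faces K m) ⟩
        fromℕ (length (filter (_⊆? facet i) (faces K m))) ≡⟨ cong fromℕ (count-ridges K m (face-at K (suc m) i)) ⟩
        fromℕ (suc (suc m))                              ∎
        where open ≡-Reasoning

      gram-adjacent : ∀ {i j} → i ≢ j → IsFace K m (facet i ∩ facet j) →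
        gram b i j ≡ ι (adjacencySign K (suc m) o (facet i) (facet j))
      gram-adjacent {i} {j} i≢j R-face with index-of K R-face
      ... | σ , σ≡R = begin
        sum (λ τ → b τ i * b τ j)
          ≡⟨ sum-single σ (λ τ τ≢σ → b*b-≢∩ i≢j τ (λ eq → τ≢σ (faces-injective K m (trans eq (sym σ≡R))))) ⟩
        ι (incidence o (ridge σ) (facet i)) * ι (incidence o (ridge σ) (facet j))
          ≡⟨ cong (λ R → ι (incidence o R (facet i)) * ι (incidence o R (facet j))) σ≡R ⟩
        ι (incidence o (facet i ∩ facet j) (facet i)) * ι (incidence o (facet i ∩ facet j) (facet j))
          ≡⟨ sym (ι-* (incidence o (facet i ∩ facet j) (facet i)) (incidence o (facet i ∩ facet j) (facet j))) ⟩
        ι (adjacencySign K (suc m) o (facet i) (facet j)) ∎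
        where open ≡-Reasoning

      gram-nonadjacent : ∀ {i j} → i ≢ j → ¬ IsFace K m (facet i ∩ facet j) → gram b i j ≡ 0ℚ
      gram-nonadjacent {i} {j} i≢j ¬R-face = sum-0 (λ σ → b*b-≢∩ i≢j σ
        (λ eq → ¬R-face (subst (IsFace K m) eq (face-at K m σ))))

      module Switched (s : Fin (#faces K (suc m)) → ℤ) (s² : ∀ i → s i ℤ.* s i ≡ 1ℤ) where

        C : Fin (#faces K m) → Fin (#faces K (suc m)) → ℤ
        C σ i = boundary o m σ i ℤ.* s i

        L≡CCᵀ : ∀ σ τ → upLaplacian o (suc m ℕ.∸ 1) σ τ ≡ sumℤ (λ i → C σ i ℤ.* C τ i)
        L≡CCᵀ σ τ = MonoidSum.sum-cong-≗ ℤ.+-0-monoid {n = #faces K (suc m)} (λ i → sym (begin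
          (B σ i ℤ.* s i) ℤ.* (B τ i ℤ.* s i)
            ≡⟨ solve 3 (λ x y s → (x :* s) :* (y :* s) := x :* y :* (s :* s)) refl (B σ i) (B τ i) (s i) ⟩
          B σ i ℤ.* B τ i ℤ.* (s i ℤ.* s i)
            ≡⟨ cong (B σ i ℤ.* B τ i ℤ.*_) (s² i) ⟩
          B σ i ℤ.* B τ i ℤ.* 1ℤ
            ≡⟨ ℤ.*-identityʳ (B σ i ℤ.* B τ i) ⟩
          B σ i ℤ.* B τ i ∎))
          where
          open ≡-Reasoning
          open ℤ.+-*-Solver
          B = boundary o m

        A : Fin (#faces K (suc m)) → Fin (#faces K (suc m)) → ℚ
        A = gram (λ σ i → ι (C σ i))

        private
          A≡ : ∀ i j → A i j ≡ ι (s i) * (gram b i j * ι (s j))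
          A≡ i j = begin
            sum (λ σ → ι (C σ i) * ι (C σ j))
              ≡⟨ sum-cong-≗ (λ σ → trans
                   (cong₂ _*_ (ι-* (boundary o m σ i) (s i)) (ι-* (boundary o m σ j) (s j)))
                   (solve 4 (λ x s y t → (x :* s) :* (y :* t) := (s :* t) :* (x :* y)) refl
                     (b σ i) (ι (s i)) (b σ j) (ι (s j)))) ⟩
            sum (λ σ → (ι (s i) * ι (s j)) * (b σ i * b σ j))
              ≡⟨ sym (*-distribˡ-sum (ι (s i) * ι (s j)) (λ σ → b σ i * b σ j)) ⟩
            (ι (s i) * ι (s j)) * gram b i j
              ≡⟨ solve 3 (λ s t g → (s :* t) :* g := s :* (g :* t)) refl (ι (s i)) (ι (s j)) (gram b i j) ⟩
            ι (s i) * (gram b i j * ι (s j)) ∎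
            where
            open ≡-Reasoning
            open +-*-Solver

        -- The summand 1 is kept apart: it is the diagonal of `J` when `A` is compared with
        -- `k I + J`.
        A-diagonal : ∀ i → A i i ≡ fromℕ (suc m) + 1ℚ
        A-diagonal i = begin
          A i i
            ≡⟨ A≡ i i ⟩
          ι (s i) * (gram b i i * ι (s i))
            ≡⟨ solve 2 (λ s g → s :* (g :* s) := g :* (s :* s)) refl (ι (s i)) (gram b i i) ⟩
          gram b i i * (ι (s i) * ι (s i))
            ≡⟨ cong₂ _*_ (gram-diagonal i) (trans (sym (ι-* (s i) (s i))) (cong ι (s² i))) ⟩
          fromℕ (suc (suc m)) * 1ℚ
            ≡⟨ trans (*-identityʳ (fromℕ (suc (suc m)))) (trans (fromℕ-suc (suc m)) (+-comm 1ℚ (fromℕ (suc m)))) ⟩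
          fromℕ (suc m) + 1ℚ ∎
          where
          open ≡-Reasoning
          open +-*-Solver

        A-adjacent : ∀ {i j} → i ≢ j → IsFace K m (facet i ∩ facet j) →
          s i ℤ.* (adjacencySign K (suc m) o (facet i) (facet j) ℤ.* s j) ≡ 1ℤ → A i j ≡ 1ℚ
        A-adjacent {i} {j} i≢j R-face switch = begin
          A i j                              ≡⟨ A≡ i j ⟩
          ι (s i) * (gram b i j * ι (s j))   ≡⟨ cong (λ g → ι (s i) * (g * ι (s j))) (gram-adjacent i≢j R-face) ⟩
          ι (s i) * (ι ε * ι (s j))          ≡⟨ cong (ι (s i) *_) (sym (ι-* ε (s j))) ⟩
          ι (s i) * ι (ε ℤ.* s j)            ≡⟨ sym (ι-* (s i) (ε ℤ.* s j)) ⟩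
          ι (s i ℤ.* (ε ℤ.* s j))            ≡⟨ cong ι switch ⟩
          1ℚ                                 ∎
          where
          open ≡-Reasoning
          ε = adjacencySign K (suc m) o (facet i) (facet j)

        A-nonadjacent : ∀ {i j} → i ≢ j → ¬ IsFace K m (facet i ∩ facet j) → A i j ≡ 0ℚ
        A-nonadjacent {i} {j} i≢j ¬R-face = trans (A≡ i j) (trans
          (cong (ι (s i) *_) (trans (cong (_* ι (s j)) (gram-nonadjacent i≢j ¬R-face)) (*-zeroˡ (ι (s j)))))
          (*-zeroʳ (ι (s i))))

        -- Row `i` acts as that of `k I + J` once its off-diagonal entries are 1 wherever `z` is
        -- nonzero. This covers every `z` when all facets share a ridge, and the indicator of a star
        -- when `i` belongs to the star.
        A-⊛ : ∀ z i → (∀ j → j ≢ i → A i j * z j ≡ z j) → (A ⊛ z) i ≡ fromℕ (suc m) * z i + sum z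
        A-⊛ z i fixes = begin
          sum (λ j → A i j * z j)
            ≡⟨ sum-cong-≗ split ⟩
          sum (λ j → δ j + z j)
            ≡⟨ ∑-distrib-+ δ z ⟩
          sum δ + sum z
            ≡⟨ cong (_+ sum z) (trans (sum-single i off) on) ⟩
          fromℕ (suc m) * z i + sum z ∎
          where
          open ≡-Reasoning
          δ : Vector (#faces K (suc m))
          δ j with j Fin.≟ i
          ... | yes _ = fromℕ (suc m) * z i
          ... | no  _ = 0ℚ
          on : δ i ≡ fromℕ (suc m) * z i
          on with i Fin.≟ i
          ... | yes _  = refl
          ... | no i≢i = contradiction refl i≢i
          off : ∀ j → j ≢ i → δ j ≡ 0ℚ
          off j j≢i with j Fin.≟ i
          ... | yes j≡i = contradiction j≡i j≢i
          ... | no  _   = refl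
          split : ∀ j → A i j * z j ≡ δ j + z j
          split j with j Fin.≟ i
          ... | yes refl = trans (cong (_* z i) (A-diagonal i))
            (trans (*-distribʳ-+ (z i) (fromℕ (suc m)) 1ℚ) (cong (_+_ (fromℕ (suc m) * z i)) (*-identityˡ (z i))))
          ... | no j≢i  = trans (fixes j j≢i) (sym (+-identityˡ (z j)))

-- The facet graph and the two implications.

module FacetGraph where

  open RationalSums
  open PositiveOperators using (Vector)
  open PerronFrobenius using (gram; _⊛_; exceeding-eigenpair)
  open Spectrum
  open SubsetLists
  open Incidence
  open import Data.Empty using (⊥; ⊥-elim)
  open import Data.Fin.Base using (Fin; zero; suc)
  import Data.Fin.Properties as Fin
  open import Data.Fin.Subset using (Subset; _⊆_; _∩_)
  open import Data.Fin.Subset.Properties using (_⊆?_; p∩q⊆p; p∩q⊆q; ∩-comm)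
  open import Data.Integer.Base as ℤ using (ℤ; +_; 1ℤ)
  import Data.Integer.Properties as ℤ
  import Data.Integer.Solver as ℤ
  open import Data.List.Base using ([]; _∷_; length; lookup; filter; map)
  open import Data.List.Extrema.Nat using (argmax-sel; xs≤max; max≤v⁺)
  open import Data.List.Membership.Propositional using (_∈_)
  open import Data.List.Membership.Propositional.Properties
    using (∈-filter⁺; ∈-filter⁻; ∈-map⁺; ∈-map⁻; ∈-length)
  open import Data.List.Properties using (filter-all; length-filter)
  open import Data.List.Relation.Unary.All as All using (All)
  import Data.List.Relation.Unary.All.Properties as All
  open import Data.List.Relation.Unary.Any using (here)
  open import Data.Nat.Base as ℕ using (ℕ; zero; suc)
  import Data.Nat.Properties as ℕ
  open import Data.Product.Base using (∃-syntax; _×_; _,_; proj₁; proj₂)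
  open import Data.Rational.Base using (0ℚ; 1ℚ; _+_; _*_; _≤_)
  open import Data.Rational.Properties
  open import Data.Sum.Base using (inj₁; inj₂)
  open import Function.Base using (id)
  open import Relation.Binary.Construct.Closure.ReflexiveTransitive using (Star; ε; _◅_)
  open import Relation.Binary.PropositionalEquality
  open import Relation.Nullary.Decidable using (Dec; yes; no; decidable-stable)
  open import Relation.Nullary.Negation using (¬_; contradiction)
  open import Relation.Unary using (Decidable)

  𝟙-yes : ∀ {P : Set} (d : Dec P) → P → 𝟙 d ≡ 1ℚ
  𝟙-yes (yes _) p = refl
  𝟙-yes (no ¬p) p = contradiction p ¬p

  𝟙-no : ∀ {P : Set} (d : Dec P) → ¬ P → 𝟙 d ≡ 0ℚ
  𝟙-no (yes p) ¬p = contradiction p ¬p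
  𝟙-no (no _)  ¬p = refl

  0≤𝟙 : ∀ {P : Set} (d : Dec P) → 0ℚ ≤ 𝟙 d
  0≤𝟙 (yes _) = 0≤fromℕ 1
  0≤𝟙 (no _)  = ≤-refl

  sum-ones : ∀ n → sum {n} (λ _ → 1ℚ) ≡ fromℕ n
  sum-ones zero    = refl
  sum-ones (suc n) = trans (cong (_+_ 1ℚ) (sum-ones n)) (sym (fromℕ-suc n))

  nonempty-filter : ∀ {A : Set} {P : A → Set} (P? : Decidable P) xs → 0 ℕ.< length (filter P? xs) →
    ∃[ x ] (x ∈ xs × P x)
  nonempty-filter P? xs 0<l with filter P? xs in eq
  nonempty-filter P? xs ()  | []
  nonempty-filter P? xs 0<l | x ∷ _ = x , ∈-filter⁻ P? (subst (x ∈_) (sym eq) (here refl))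

  module _ {n : ℕ} (K : SimplicialComplex n) (m : ℕ) where

    private
      D = maxUpperDegree K (suc m)
      degree = upperDegree K (suc m)

    ∈-faces : ∀ {j p} → IsFace K j p → p ∈ faces K j
    ∈-faces {j} {p} = ∈-filter⁺ (isFace? K j) (∈-allSubsets p)

    faces-∈ : ∀ {j p} → p ∈ faces K j → IsFace K j p
    faces-∈ {j} p∈ = proj₂ (∈-filter⁻ (isFace? K j) {xs = allSubsets n} p∈)

    degree≤D : ∀ {ρ} → IsFace K m ρ → degree ρ ℕ.≤ D
    degree≤D ρ-face = All.lookup (xs≤max 0 (map degree (faces K m))) (∈-map⁺ degree (∈-faces ρ-face))

    -- Besides a ridge of maximal degree this yields a facet `G` through it, the start of the walks
    -- that test whether all facets contain the ridge.
    D-attained : ∀ {F} → IsFace K (suc m) F →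
      ∃[ ρ ] (IsFace K m ρ × degree ρ ≡ D × ∃[ G ] (IsFace K (suc m) G × ρ ⊆ G))
    D-attained {F} F-face with nonempty-filter (_⊆? F) (faces K m)
                                 (subst (0 ℕ.<_) (sym (count-ridges K m F-face)) (ℕ.s≤s ℕ.z≤n))
    ... | τ , τ∈ , τ⊆F = go (argmax-sel id 0 (map degree (faces K m)))
      where
      0<D : 0 ℕ.< D
      0<D = ℕ.<-≤-trans (∈-length (∈-filter⁺ (τ ⊆?_) (∈-faces F-face) τ⊆F)) (degree≤D (faces-∈ τ∈))
      go : _ → ∃[ ρ ] (IsFace K m ρ × degree ρ ≡ D × ∃[ G ] (IsFace K (suc m) G × ρ ⊆ G))
      -- `max` may return its default 0; a ridge of `F` has positive degree and excludes this.
      go (inj₁ D≡0) = ⊥-elim (ℕ.<-irrefl (sym D≡0) 0<D)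
      go (inj₂ D∈) with ∈-map⁻ degree D∈
      ... | ρ , ρ∈ , D≡ with nonempty-filter (ρ ⊆?_) (faces K (suc m)) (subst (0 ℕ.<_) D≡ 0<D)
      ...   | G , G∈ , ρ⊆G = ρ , faces-∈ ρ∈ , sym D≡ , G , faces-∈ G∈ , ρ⊆G

    common-ridge⇒D≡#facets : ∀ {ρ} → IsFace K m ρ → (∀ F → IsFace K (suc m) F → ρ ⊆ F) → D ≡ #faces K (suc m)
    common-ridge⇒D≡#facets {ρ} ρ-face ρ⊆ = ℕ.≤-antisym
      (max≤v⁺ {xs = map degree (faces K m)} ℕ.z≤n (All.map⁺ (All.tabulate (λ {τ} _ → length-filter (τ ⊆?_) (faces K (suc m))))))
      (subst (ℕ._≤ D) (cong length (filter-all (ρ ⊆?_) (All.tabulate (λ {F} F∈ → ρ⊆ F (faces-∈ F∈)))))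
        (degree≤D ρ-face))

    module _ (o : Orientation K) where

      private
        N = #faces K (suc m)
        F[_] : Fin N → Subset n
        F[_] = facet o m
        sign = adjacencySign K (suc m) o

      facet-face : ∀ i → IsFace K (suc m) F[ i ]
      facet-face = face-at K (suc m)

      common⇒∩ : ∀ {ρ i j} → IsFace K m ρ → i ≢ j → ρ ⊆ F[ i ] → ρ ⊆ F[ j ] → ρ ≡ F[ i ] ∩ F[ j ]
      common⇒∩ {i = i} {j} (_ , ∣ρ∣≡) i≢j ρ⊆i ρ⊆j = common-subset≡∩
        (trans (proj₂ (facet-face i)) (sym (proj₂ (facet-face j))))
        (λ eq → i≢j (faces-injective K (suc m) eq)) ρ⊆i ρ⊆j
        (trans (proj₂ (facet-face i)) (cong suc (sym ∣ρ∣≡)))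

      common-ridge⇒largest : ∃[ F ] IsFace K (suc m) F → HaveCommonRidge K (suc m) →
        IsLargestEigenvalue (real (upLaplacian o (suc m ℕ.∸ 1))) (fromℤ (+ (maxUpperDegree K (suc m) ℕ.+ suc m)))
      common-ridge⇒largest (F , F-face) (ρ , ρ-face , ρ⊆) =
        CompleteGram.isLargest C (upLaplacian o (suc m ℕ.∸ 1)) L≡CCᵀ (fromℕ (suc m)) (0≤fromℕ (suc m)) (proj₁ (index-of K F-face))
          (λ z i → A-⊛ z i (λ j j≢i → trans (cong (_* z j) (A≡1 (λ i≡j → j≢i (sym i≡j)))) (*-identityˡ (z j))))
          (+ (D ℕ.+ suc m)) ιμ≡
        where
        -- Any two facets meet exactly in `ρ`, so their adjacency sign is `s i` times `s j`: the
        -- incidences with `ρ` are themselves a switching function.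
        s : Fin N → ℤ
        s i = incidence o ρ F[ i ]
        ρ⊆F : ∀ i → ρ ⊆ F[ i ]
        ρ⊆F i = ρ⊆ F[ i ] (facet-face i)
        s² : ∀ i → s i ℤ.* s i ≡ 1ℤ
        s² i = incidence² o (proj₁ (facet-face i)) (ρ⊆F i)
          (trans (proj₂ (facet-face i)) (cong suc (sym (proj₂ ρ-face))))
        open Switched o m s s²
        A≡1 : ∀ {i j} → i ≢ j → A i j ≡ 1ℚ
        A≡1 {i} {j} i≢j = A-adjacent i≢j (subst (IsFace K m) ρ≡ ρ-face) (begin
          s i ℤ.* (sign F[ i ] F[ j ] ℤ.* s j)
            ≡⟨ cong (λ R → s i ℤ.* (incidence o R F[ i ] ℤ.* incidence o R F[ j ] ℤ.* s j)) (sym ρ≡) ⟩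
          s i ℤ.* (s i ℤ.* s j ℤ.* s j)
            ≡⟨ solve 2 (λ x y → x :* (x :* y :* y) := (x :* x) :* (y :* y)) refl (s i) (s j) ⟩
          (s i ℤ.* s i) ℤ.* (s j ℤ.* s j)
            ≡⟨ cong₂ ℤ._*_ (s² i) (s² j) ⟩
          1ℤ ∎)
          where
          open ≡-Reasoning
          open ℤ.+-*-Solver
          ρ≡ : ρ ≡ F[ i ] ∩ F[ j ]
          ρ≡ = common⇒∩ ρ-face i≢j (ρ⊆F i) (ρ⊆F j)
        ιμ≡ : ι (+ (D ℕ.+ suc m)) ≡ fromℕ (suc m) + sum {N} (λ _ → 1ℚ)
        ιμ≡ = begin
          ι (+ (D ℕ.+ suc m))                  ≡⟨ ι-+ (+ D) (+ suc m) ⟩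
          fromℕ D + fromℕ (suc m)              ≡⟨ +-comm (fromℕ D) (fromℕ (suc m)) ⟩
          fromℕ (suc m) + fromℕ D              ≡⟨ cong (λ d → fromℕ (suc m) + fromℕ d)
                                                    (common-ridge⇒D≡#facets ρ-face ρ⊆) ⟩
          fromℕ (suc m) + fromℕ N              ≡⟨ cong (_+_ (fromℕ (suc m))) (sym (sum-ones N)) ⟩
          fromℕ (suc m) + sum {N} (λ _ → 1ℚ)   ∎
          where open ≡-Reasoning

      private
        _~_ = Adjacent K (suc m)

        ~-sym : ∀ {F G} → F ~ G → G ~ F
        ~-sym {F} {G} (f , g , F≢G , R) =
          g , f , (λ eq → F≢G (sym eq)) , subst (IsFace K m) (∩-comm F G) R

        sign-sym : ∀ F G → sign F G ≡ sign G F
        sign-sym F G = trans (ℤ.*-comm (incidence o (F ∩ G) F) (incidence o (F ∩ G) G))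
          (cong (λ R → incidence o R G ℤ.* incidence o R F) (∩-comm F G))

        sign² : ∀ {F G} → F ~ G → sign F G ℤ.* sign F G ≡ 1ℤ
        sign² {F} {G} ((F∈K , ∣F∣≡) , (G∈K , ∣G∣≡) , _ , (_ , ∣R∣≡)) = trans
          (solve 2 (λ x y → (x :* y) :* (x :* y) := (x :* x) :* (y :* y)) refl
            (incidence o (F ∩ G) F) (incidence o (F ∩ G) G))
          (cong₂ ℤ._*_
            (incidence² o F∈K (p∩q⊆p F G) (trans ∣F∣≡ (cong suc (sym ∣R∣≡))))
            (incidence² o G∈K (p∩q⊆q F G) (trans ∣G∣≡ (cong suc (sym ∣R∣≡)))))
          where open ℤ.+-*-Solver

        crossing : ∀ ρ {F G} → Star _~_ F G → ρ ⊆ F → ¬ ρ ⊆ G →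
          ∃[ H ] ∃[ H′ ] (H ~ H′ × ρ ⊆ H × ¬ ρ ⊆ H′)
        crossing ρ ε                                   ρ⊆F ρ⊈G = contradiction (λ {x} → ρ⊆F {x}) ρ⊈G
        crossing ρ (_◅_ {i = F} {j = H} e p) ρ⊆F ρ⊈G with ρ ⊆? H
        ... | yes ρ⊆H = crossing ρ p ρ⊆H ρ⊈G
        ... | no ρ⊈H  = F , H , e , ρ⊆F , ρ⊈H

      module _ (i₀ : Fin N) (connected : FacetConnected K (suc m)) (balanced : FacetBalanced K (suc m) o) where

        private
          module Σ[K] = Switching.Balance _≟ₛ_ _~_ sign (λ (_ , _ , F≢G , _) → F≢G) ~-sym sign-sym sign² balanced

          path : ∀ i → Star _~_ F[ i₀ ] F[ i ]
          path i = connected F[ i₀ ] F[ i ] (facet-face i₀) (facet-face i)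

          s : Fin N → ℤ
          s i = Σ[K].starSign (path i)

          open Switched o m s (λ i → Σ[K].starSign² (path i))

          A≡1 : ∀ {i j} → i ≢ j → IsFace K m (F[ i ] ∩ F[ j ]) → A i j ≡ 1ℚ
          A≡1 {i} {j} i≢j R = A-adjacent i≢j R (Σ[K].starSign-switch (path i) (path j)
            (facet-face i , facet-face j , (λ eq → i≢j (faces-injective K (suc m) eq)) , R))

          1≤Aᵢᵢ : ∀ i → 1ℚ ≤ A i i
          1≤Aᵢᵢ i = subst₂ _≤_ (+-identityˡ 1ℚ) (sym (A-diagonal i)) (+-monoˡ-≤ 1ℚ (0≤fromℕ (suc m)))

          0≤A : ∀ i j → 0ℚ ≤ A i j
          0≤A i j with i Fin.≟ j | isFace? K m (F[ i ] ∩ F[ j ])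
          ... | yes refl | _     = ≤-trans (0≤fromℕ 1) (1≤Aᵢᵢ i)
          ... | no i≢j   | yes R = subst (0ℚ ≤_) (sym (A≡1 i≢j R)) (0≤fromℕ 1)
          ... | no i≢j   | no ¬R = ≤-reflexive (sym (A-nonadjacent i≢j ¬R))

          1≤A : ∀ {i j} → F[ i ] ~ F[ j ] → 1ℚ ≤ A i j
          1≤A (_ , _ , F≢G , R) = ≤-reflexive (sym (A≡1 (λ { refl → F≢G refl }) R))

          walk : ∀ {F G} → Star _~_ F G → ∀ i j → F[ i ] ≡ F → F[ j ] ≡ G → Star (λ i j → 1ℚ ≤ A i j) i j
          walk ε i j Fᵢ≡ Fⱼ≡ with faces-injective K (suc m) {i} {j} (trans Fᵢ≡ (sym Fⱼ≡))
          ... | refl = ε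
          walk (e@(_ , H-face , _) ◅ p) i j Fᵢ≡ Fⱼ≡ with index-of K H-face
          ... | h , Fₕ≡ = 1≤A (subst₂ _~_ (sym Fᵢ≡) (sym Fₕ≡) e) ◅ walk p h j Fₕ≡ Fⱼ≡

        not-covered⇒not-largest : ∀ {ρ h f} → IsFace K m ρ → upperDegree K (suc m) ρ ≡ D →
          F[ h ] ~ F[ f ] → ρ ⊆ F[ h ] → ¬ ρ ⊆ F[ f ] →
          ¬ IsLargestEigenvalue (real (upLaplacian o (suc m ℕ.∸ 1))) (fromℤ (+ (maxUpperDegree K (suc m) ℕ.+ suc m)))
        not-covered⇒not-largest {ρ} {h} {f} ρ-face degree≡D (_ , _ , Fₕ≢F , R-face) ρ⊆h ρ⊈f =
          exceeding⇒not-largest C (upLaplacian o (suc m ℕ.∸ 1)) L≡CCᵀ {+ (D ℕ.+ suc m)} (exceeding-eigenpair (λ σ i → ι (C σ i)) 0≤A 1≤Aᵢᵢ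
            (λ i j → walk (connected F[ i ] F[ j ] (facet-face i) (facet-face j)) i j refl refl)
            {ι (+ (D ℕ.+ suc m))} {χ} {e} {h} {f}
            (0≤fromℕ (D ℕ.+ suc m)) (λ i → 0≤𝟙 (ρ ⊆? F[ i ])) (≤-reflexive (sym (χ-in h ρ⊆h)))
            (λ i → 0≤𝟙 (i Fin.≟ f)) (≤-reflexive (sym (𝟙-yes (f Fin.≟ f) refl)))
            (λ i → subsolution i (ρ ⊆? F[ i ]) (i Fin.≟ f)))
          where
          χ e : Vector N
          χ i = 𝟙 (ρ ⊆? F[ i ])
          e i = 𝟙 (i Fin.≟ f)
          χ-in : ∀ i → ρ ⊆ F[ i ] → χ i ≡ 1ℚ
          χ-in i = 𝟙-yes (ρ ⊆? F[ i ])
          χ-out : ∀ i → ¬ ρ ⊆ F[ i ] → χ i ≡ 0ℚ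
          χ-out i = 𝟙-no (ρ ⊆? F[ i ])
          μ = ι (+ (D ℕ.+ suc m))
          0≤Aχ : ∀ i j → 0ℚ ≤ A i j * χ j
          0≤Aχ i j = 0≤* (0≤A i j) (0≤𝟙 (ρ ⊆? F[ j ]))
          h≢f : h ≢ f
          h≢f refl = Fₕ≢F refl
          fixes : ∀ i → ρ ⊆ F[ i ] → ∀ j → j ≢ i → A i j * χ j ≡ χ j
          fixes i ρ⊆i j j≢i with ρ ⊆? F[ j ]
          ... | yes ρ⊆j = trans (*-identityʳ (A i j)) (A≡1 (λ i≡j → j≢i (sym i≡j))
            (subst (IsFace K m) (common⇒∩ ρ-face (λ i≡j → j≢i (sym i≡j)) ρ⊆i ρ⊆j) ρ-face))
          ... | no _    = *-zeroʳ (A i j)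
          outside-sum : ∀ i → ¬ ρ ⊆ F[ i ] → μ * χ i + e i ≡ e i
          outside-sum i ρ⊈i = trans (cong (λ c → μ * c + e i) (χ-out i ρ⊈i))
            (trans (cong (_+ e i) (*-zeroʳ μ)) (+-identityˡ (e i)))
          -- On the star there is equality: `k` comes from the diagonal and `D` from summing `χ`,
          -- while `e` vanishes as `f` lies outside. Off the star `χ` vanishes, and the 1 required
          -- at `f` is contributed by its neighbour `h`.
          subsolution : ∀ i → Dec (ρ ⊆ F[ i ]) → Dec (i ≡ f) → μ * χ i + e i ≤ (A ⊛ χ) i
          subsolution i (yes ρ⊆i) _ = ≤-reflexive (begin
            μ * χ i + e i
              ≡⟨ cong₂ (λ c d → μ * c + d) (χ-in i ρ⊆i)
                   (𝟙-no (i Fin.≟ f) (λ { refl → ρ⊈f ρ⊆i })) ⟩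
            μ * 1ℚ + 0ℚ
              ≡⟨ trans (+-identityʳ (μ * 1ℚ)) (*-identityʳ μ) ⟩
            μ
              ≡⟨ trans (ι-+ (+ D) (+ suc m)) (+-comm (fromℕ D) (fromℕ (suc m))) ⟩
            fromℕ (suc m) + fromℕ D
              ≡⟨ cong₂ _+_ (trans (sym (*-identityʳ (fromℕ (suc m)))) (cong (fromℕ (suc m) *_) (sym (χ-in i ρ⊆i))))
                   (trans (cong fromℕ (sym degree≡D)) (sym (sum-𝟙 (ρ ⊆?_) (faces K (suc m))))) ⟩
            fromℕ (suc m) * χ i + sum χ
              ≡⟨ sym (A-⊛ χ i (fixes i ρ⊆i)) ⟩
            (A ⊛ χ) i ∎)
            where open ≡-Reasoning
          subsolution i (no ρ⊈i) (no i≢f) = ≤-trans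
            (≤-reflexive (trans (outside-sum i ρ⊈i) (𝟙-no (i Fin.≟ f) i≢f))) (0≤sum (0≤Aχ i))
          subsolution i (no ρ⊈i) (yes refl) = begin
            μ * χ f + e f    ≡⟨ trans (outside-sum f ρ⊈i) (𝟙-yes (f Fin.≟ f) refl) ⟩
            1ℚ * 1ℚ          ≡⟨ cong₂ _*_ (sym (A≡1 (λ f≡h → h≢f (sym f≡h))
                                  (subst (IsFace K m) (∩-comm F[ h ] F[ f ]) R-face))) (sym (χ-in h ρ⊆h)) ⟩
            A f h * χ h      ≤⟨ term≤sum (0≤Aχ f) h ⟩
            (A ⊛ χ) f        ∎
            where open ≤-Reasoning

      -- Any ridge of maximal degree turns out to be the common one. A facet missing it would give a
      -- walk that leaves its star, and the edge where this happens pushes an eigenvalue above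
      -- `D + k`.
      largest⇒common-ridge : ∃[ F ] IsFace K (suc m) F →
        FacetConnected K (suc m) → FacetBalanced K (suc m) o →
        IsLargestEigenvalue (real (upLaplacian o (suc m ℕ.∸ 1))) (fromℤ (+ (maxUpperDegree K (suc m) ℕ.+ suc m))) → HaveCommonRidge K (suc m)
      largest⇒common-ridge (F , F-face) connected balanced largest = go (D-attained F-face)
        where
        impossible : ∀ {ρ H H′} → IsFace K m ρ → upperDegree K (suc m) ρ ≡ D →
          H ~ H′ → ρ ⊆ H → ¬ ρ ⊆ H′ →
          ∃[ h ] (F[ h ] ≡ H) → ∃[ f ] (F[ f ] ≡ H′) → ⊥
        impossible {ρ} ρ-face degree≡D H~H′ ρ⊆H ρ⊈H′ (h , Fₕ≡H) (f , F≡H′) =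
          not-covered⇒not-largest h connected balanced {ρ} {h} {f} ρ-face degree≡D
            (subst₂ _~_ (sym Fₕ≡H) (sym F≡H′) H~H′) (subst (ρ ⊆_) (sym Fₕ≡H) ρ⊆H)
            (λ ρ⊆ → ρ⊈H′ (subst (ρ ⊆_) F≡H′ ρ⊆)) largest
        no-crossing : ∀ {ρ} → IsFace K m ρ → upperDegree K (suc m) ρ ≡ D →
          ¬ (∃[ H ] ∃[ H′ ] (H ~ H′ × ρ ⊆ H × ¬ ρ ⊆ H′))
        no-crossing {ρ} ρ-face degree≡D (H , H′ , H~H′ , ρ⊆H , ρ⊈H′) =
          impossible {ρ} {H} {H′} ρ-face degree≡D H~H′ ρ⊆H ρ⊈H′
            (index-of K (proj₁ H~H′)) (index-of K (proj₁ (proj₂ H~H′)))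
        go : ∃[ ρ ] (IsFace K m ρ × degree ρ ≡ D × ∃[ G ] (IsFace K (suc m) G × ρ ⊆ G)) →
          HaveCommonRidge K (suc m)
        go (ρ , ρ-face , degree≡D , G , G-face , ρ⊆G) = ρ , ρ-face , λ H H-face →
          -- Inclusion of finite subsets is decidable, so the refutation of its negation suffices.
          decidable-stable (ρ ⊆? H) λ ρ⊈H →
            no-crossing {ρ} ρ-face degree≡D (crossing ρ (connected G H G-face H-face) ρ⊆G ρ⊈H)

open import Data.Integer.Base using (+_)
open import Data.Nat.Base using (ℕ; _+_; _∸_; _≤_; suc)
open import Data.Product.Base using (_,_)
open import Function.Bundles using (_⇔_; mk⇔)

theorem4p24 : ∀ {n : ℕ} (K : SimplicialComplex n) (o : Orientation K) (k : ℕ) →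
    1 ≤ k → HasDimension K k →
    FacetConnected K k → FacetBalanced K k o →
    IsLargestEigenvalue (real (upLaplacian o (k ∸ 1))) (fromℤ (+ (maxUpperDegree K k + k)))
    ⇔ HaveCommonRidge K k
-- With `k = suc m` the truncated `k ∸ 1` computes to `m`, the dimension of the ridges.
theorem4p24 K o (suc m) _ (facet , _) connected balanced = mk⇔
  (FacetGraph.largest⇒common-ridge K m o facet connected balanced)
  (FacetGraph.common-ridge⇒largest K m o facet)
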